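{- For each integer $n \ge 1$, the Tutte polynomial $T_n(x,y)=T(G_n;x,y)$ of the Farey graph $G_n$ is given by $$T_n(x,y)=T_{1,n}(x,y)+T_{2,n}(x,y),$$ where the polynomials $T_{1,n}=T_{1,n}(x,y)$ and $T_{2,n}=T_{2,n}(x,y)$ (the contributions to the Tutte polynomial of the spanning subgraphs of $G_n$ in which the two special vertices lie in the same connected component, respectively in different connected components) satisfy the recursive relations $$T_{1,n}= y\,T_{1,n-1}^2 +\frac{2}{x-1}\,T_{1,n-1}T_{2,n-1}+\frac{1}{x-1}\,T_{2,n-1}^2,$$ $$T_{2,n}= T_{2,n-1}^2+2\,T_{1,n-1}T_{2,n-1},$$ with initial conditions $T_{1,0}(x,y)=1$ and $T_{2,0}(x,y)=x-1$. (The identities are understood in the field of rational functions in $x,y$.)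
   Context: Farey graphs. The Farey graphs $G_n$ ($n\ge 0$), each with two distinguished ("special") vertices $X_n,Y_n$, are defined recursively. $G_0$ is a single edge joining its two special vertices $X_0$ and $Y_0$. For $n\ge 1$, take two disjoint copies $G_{n-1}^1,G_{n-1}^2$ of $G_{n-1}$, with special vertices $X_{n-1}^i,Y_{n-1}^i$ ($i=1,2$); identify $Y_{n-1}^1$ with $X_{n-1}^2$ into one vertex, and add a new edge $e_n$ joining $X_{n-1}^1$ and $Y_{n-1}^2$. The result is $G_n$, with special vertices $X_n=X_{n-1}^1$ and $Y_n=Y_{n-1}^2$. It has $2^n+1$ vertices and $2^{n+1}-1$ edges. Tutte polynomial. A spanning subgraph $H$ of a graph $G$ is a subgraph with $V(H)=V(G)$ and $E(H)\subseteq E(G)$. With $k(H)$ the number of connected components of $H$, the rank is $r(H)=|V(H)|-k(H)$ and the nullity is $n(H)=|E(H)|-r(H)$. The Tutte polynomial is $$T(G;x,y)=\sum_{H}(x-1)^{r(G)-r(H)}(y-1)^{n(H)},$$ the sum being over all spanning subgraphs $H$ of $G$. Partial sums. Let $G_{1,n}$ be the set of spanning subgraphs of $G_n$ in which $X_n$ and $Y_n$ belong to the same connected component, and $G_{2,n}$ the set of spanning subgraphs of $G_n$ in which $X_n$ and $Y_n$ belong to two different connected components. For $i=1,2$ and $n\ge0$ define $$T_{i,n}(x,y)=\sum_{H\in G_{i,n}}(x-1)^{r(G_n)-r(H)}(y-1)^{n(H)}.$$ -}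

module Defs where

open import Algebra.Apartness.Bundles using (HeytingField)
open import Algebra.Bundles using (CommutativeRing)
import Algebra.Properties.CommutativeSemigroup as CommutativeSemigroupProperties
import Algebra.Properties.Group as GroupProperties
import Algebra.Properties.Ring as RingProperties
import Algebra.Properties.Semiring.Exp as Exp
import Algebra.Solver.Ring.NaturalCoefficients.Default as SemiringSolver
open import Data.Fin.Base using (Fin; zero; suc; _↑ˡ_; _↑ʳ_; punchIn; punchOut)
open import Data.Fin.Properties
  using (punchInᵢ≢i; punchOut-cong; punchOut-injective; punchOut-punchIn)
  renaming (_≟_ to _≟ᶠ_)
open import Data.Fin.Subset using (Subset; inside; outside; _∈_; ⊤; ∣_∣)
import Data.Integer.Base as ℤ
import Data.Integer.Properties as ℤ
open import Data.List.Base using (List; []; _∷_; map; filter; foldr; _++_)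
open import Data.Nat.Base using (ℕ; zero; suc; _∸_) renaming (_+_ to _+ℕ_)
open import Data.Product.Base using (∃; _×_; _,_)
import Data.Product.Base as Product
open import Data.Sum.Base using (_⊎_; inj₁; inj₂)
open import Data.Vec.Base as Vec using (Vec; []; _∷_; lookup; here; there)
open import Function.Base using (id; _∘_)
open import Function.Bundles using (_⇔_; mk⇔; Equivalence)
open import Function.Definitions using (StrictlySurjective)
open import Level using (0ℓ; _⊔_) renaming (suc to lsuc)
open import Relation.Binary.Construct.Closure.Equivalence as EqClosure using (EqClosure)
import Relation.Binary.Construct.On as On
open import Relation.Binary.Core using (Rel; _⇒_)
open import Relation.Binary.Definitions using (Decidable)
open import Relation.Binary.PropositionalEquality as ≡ using (_≡_; _≢_)
open import Relation.Nullary.Decidable using (Dec; yes; no; map′; ¬?; decidable-stable)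
open import Relation.Nullary.Negation using (¬_; contradiction)
import Relation.Binary.Reasoning.Setoid as SetoidReasoning

record IntegralDomain c ℓ : Set (lsuc (c ⊔ ℓ)) where
  field
    commutativeRing : CommutativeRing c ℓ

  open CommutativeRing commutativeRing public

  field
    _≈?_            : Decidable _≈_
    1≉0             : ¬ 1# ≈ 0#
    noZeroDivisors  : ∀ x y → x * y ≈ 0# → x ≈ 0# ⊎ y ≈ 0#

ℤ-domain : IntegralDomain 0ℓ 0ℓ
ℤ-domain = record
  { commutativeRing = ℤ.+-*-commutativeRing
  ; _≈?_            = ℤ._≟_
  ; 1≉0             = λ ()
  ; noZeroDivisors  = λ i j → ℤ.i*j≡0⇒i≡0∨j≡0 i
  }

module Polynomial {c ℓ} (D : IntegralDomain c ℓ) where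

  private
    module D = IntegralDomain D
    open RingProperties D.ring using (-0#≈0#)

  -- Coefficients in order of increasing degree; trailing zeros are allowed
  -- and are ignored by the equality _≋_.

  Poly : Set c
  Poly = List D.Carrier

  coeff : Poly → ℕ → D.Carrier
  coeff []      _       = D.0#
  coeff (a ∷ p) zero    = a
  coeff (a ∷ p) (suc i) = coeff p i

  infix 4 _≋_
  record _≋_ (p q : Poly) : Set ℓ where
    constructor coeffs
    field at : ∀ i → coeff p i D.≈ coeff q i
  open _≋_ public

  infixl 6 _⊕_
  infixl 7 _⊛_
  infixr 7 _·_

  _⊕_ : Poly → Poly → Poly
  []      ⊕ q       = q
  (a ∷ p) ⊕ []      = a ∷ p
  (a ∷ p) ⊕ (b ∷ q) = a D.+ b ∷ (p ⊕ q)

  ⊖_ : Poly → Poly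
  ⊖_ = map (λ a → D.- a)

  _·_ : D.Carrier → Poly → Poly
  a · p = map (a D.*_) p

  _⊛_ : Poly → Poly → Poly
  []      ⊛ q = []
  (a ∷ p) ⊛ q = a · q ⊕ (D.0# ∷ p ⊛ q)

  constant : D.Carrier → Poly
  constant a = a ∷ []

  variable-X : Poly
  variable-X = D.0# ∷ D.1# ∷ []

  private

    coeff-⊕ : ∀ p q i → coeff (p ⊕ q) i D.≈ coeff p i D.+ coeff q i
    coeff-⊕ []      q       i       = D.sym (D.+-identityˡ _)
    coeff-⊕ (a ∷ p) []      i       = D.sym (D.+-identityʳ _)
    coeff-⊕ (a ∷ p) (b ∷ q) zero    = D.refl
    coeff-⊕ (a ∷ p) (b ∷ q) (suc i) = coeff-⊕ p q i

    coeff-⊖ : ∀ p i → coeff (⊖ p) i D.≈ D.- coeff p i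
    coeff-⊖ []      i       = D.sym -0#≈0#
    coeff-⊖ (a ∷ p) zero    = D.refl
    coeff-⊖ (a ∷ p) (suc i) = coeff-⊖ p i

    coeff-· : ∀ a p i → coeff (a · p) i D.≈ a D.* coeff p i
    coeff-· a []      i       = D.sym (D.zeroʳ a)
    coeff-· a (b ∷ p) zero    = D.refl
    coeff-· a (b ∷ p) (suc i) = coeff-· a p i

    ≋-refl : ∀ {p} → p ≋ p
    ≋-refl = coeffs λ _ → D.refl

    ≋-sym : ∀ {p q} → p ≋ q → q ≋ p
    ≋-sym e = coeffs λ i → D.sym (at e i)

    ≋-trans : ∀ {p q r} → p ≋ q → q ≋ r → p ≋ r
    ≋-trans e f = coeffs λ i → D.trans (at e i) (at f i)

    ∷-cong : ∀ {a b p q} → a D.≈ b → p ≋ q → a ∷ p ≋ b ∷ q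
    ∷-cong e f = coeffs λ { zero → e ; (suc i) → at f i }

    ∷≋[] : ∀ {a p} → a D.≈ D.0# → p ≋ [] → a ∷ p ≋ []
    ∷≋[] e f = coeffs λ { zero → e ; (suc i) → at f i }

    tail≋[] : ∀ {a p} → a ∷ p ≋ [] → p ≋ []
    tail≋[] e = coeffs λ i → at e (suc i)

    ⊕-cong : ∀ {p p′ q q′} → p ≋ p′ → q ≋ q′ → p ⊕ q ≋ p′ ⊕ q′
    ⊕-cong {p} {p′} {q} {q′} e f = coeffs λ i →
      D.trans (coeff-⊕ p q i)
        (D.trans (D.+-cong (at e i) (at f i)) (D.sym (coeff-⊕ p′ q′ i)))

    ⊕-assoc : ∀ p q r → (p ⊕ q) ⊕ r ≋ p ⊕ (q ⊕ r)
    ⊕-assoc p q r = coeffs λ i →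
      D.trans (coeff-⊕ (p ⊕ q) r i)
      (D.trans (D.+-congʳ (coeff-⊕ p q i))
      (D.trans (D.+-assoc _ _ _)
      (D.trans (D.+-congˡ (D.sym (coeff-⊕ q r i)))
      (D.sym (coeff-⊕ p (q ⊕ r) i)))))

    ⊕-comm : ∀ p q → p ⊕ q ≋ q ⊕ p
    ⊕-comm p q = coeffs λ i →
      D.trans (coeff-⊕ p q i) (D.trans (D.+-comm _ _) (D.sym (coeff-⊕ q p i)))

    ⊕-identityʳ : ∀ p → p ⊕ [] ≋ p
    ⊕-identityʳ p = ⊕-comm p []

    ⊖-cong : ∀ {p q} → p ≋ q → ⊖ p ≋ ⊖ q
    ⊖-cong {p} {q} e = coeffs λ i →
      D.trans (coeff-⊖ p i) (D.trans (D.-‿cong (at e i)) (D.sym (coeff-⊖ q i)))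

    ⊖-inverseˡ : ∀ p → ⊖ p ⊕ p ≋ []
    ⊖-inverseˡ p = coeffs λ i →
      D.trans (coeff-⊕ (⊖ p) p i)
        (D.trans (D.+-congʳ (coeff-⊖ p i)) (D.-‿inverseˡ _))

    ⊖-inverseʳ : ∀ p → p ⊕ ⊖ p ≋ []
    ⊖-inverseʳ p = ≋-trans (⊕-comm p (⊖ p)) (⊖-inverseˡ p)

    ·-cong : ∀ {a b p q} → a D.≈ b → p ≋ q → a · p ≋ b · q
    ·-cong {a} {b} {p} {q} e f = coeffs λ i →
      D.trans (coeff-· a p i)
        (D.trans (D.*-cong e (at f i)) (D.sym (coeff-· b q i)))

    ·-distrib-⊕ : ∀ a p q → a · (p ⊕ q) ≋ a · p ⊕ a · q
    ·-distrib-⊕ a p q = coeffs λ i →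
      D.trans (coeff-· a (p ⊕ q) i)
      (D.trans (D.*-congˡ (coeff-⊕ p q i))
      (D.trans (D.distribˡ a _ _)
      (D.trans (D.+-cong (D.sym (coeff-· a p i)) (D.sym (coeff-· a q i)))
      (D.sym (coeff-⊕ (a · p) (a · q) i)))))

    ·-assoc : ∀ a b p → a · b · p ≋ (a D.* b) · p
    ·-assoc a b p = coeffs λ i →
      D.trans (coeff-· a (b · p) i)
      (D.trans (D.*-congˡ (coeff-· b p i))
      (D.trans (D.sym (D.*-assoc a b _))
      (D.sym (coeff-· (a D.* b) p i))))

    ·-zeroˡ : ∀ {a} p → a D.≈ D.0# → a · p ≋ []
    ·-zeroˡ {a} p e = coeffs λ i →
      D.trans (coeff-· a p i) (D.trans (D.*-congʳ e) (D.zeroˡ _))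

    ·-identityˡ : ∀ p → D.1# · p ≋ p
    ·-identityˡ p = coeffs λ i → D.trans (coeff-· D.1# p i) (D.*-identityˡ _)

    shift-⊕ : ∀ p q → D.0# ∷ (p ⊕ q) ≋ (D.0# ∷ p) ⊕ (D.0# ∷ q)
    shift-⊕ p q = ∷-cong (D.sym (D.+-identityˡ _)) ≋-refl

    shift-[] : D.0# ∷ [] ≋ []
    shift-[] = ∷≋[] D.refl ≋-refl

    medial : ∀ p q r s → (p ⊕ q) ⊕ (r ⊕ s) ≋ (p ⊕ r) ⊕ (q ⊕ s)
    medial = CommutativeSemigroupProperties.interchange record
      { Carrier = Poly ; _≈_ = _≋_ ; _∙_ = _⊕_
      ; isCommutativeSemigroup = record
        { isSemigroup = record
          { isMagma = record
            { isEquivalence = record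
              { refl = ≋-refl ; sym = ≋-sym ; trans = ≋-trans }
            ; ∙-cong = ⊕-cong }
          ; assoc = ⊕-assoc }
        ; comm = ⊕-comm } }

    ⊛-congˡ : ∀ p {q r} → q ≋ r → p ⊛ q ≋ p ⊛ r
    ⊛-congˡ []      e = ≋-refl
    ⊛-congˡ (a ∷ p) e =
      ⊕-cong (·-cong D.refl e) (∷-cong D.refl (⊛-congˡ p e))

    ⊛-distribˡ : ∀ p q r → p ⊛ (q ⊕ r) ≋ p ⊛ q ⊕ p ⊛ r
    ⊛-distribˡ []      q r = ≋-refl
    ⊛-distribˡ (a ∷ p) q r =
      ≋-trans
        (⊕-cong (·-distrib-⊕ a q r)
                (≋-trans (∷-cong D.refl (⊛-distribˡ p q r)) (shift-⊕ (p ⊛ q) (p ⊛ r))))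
        (medial (a · q) (a · r) (D.0# ∷ p ⊛ q) (D.0# ∷ p ⊛ r))

    ⊛-zeroʳ : ∀ p → p ⊛ [] ≋ []
    ⊛-zeroʳ []      = ≋-refl
    ⊛-zeroʳ (a ∷ p) = ∷≋[] D.refl (⊛-zeroʳ p)

    ⊛-∷ : ∀ p b q → p ⊛ (b ∷ q) ≋ b · p ⊕ (D.0# ∷ p ⊛ q)
    ⊛-∷ []      b q = ≋-sym shift-[]
    ⊛-∷ (a ∷ p) b q = ∷-cong (D.+-congʳ (D.*-comm a b))
      (≋-trans (⊕-cong (≋-refl {a · q}) (⊛-∷ p b q))
      (≋-trans (≋-sym (⊕-assoc (a · q) (b · p) _))
      (≋-trans (⊕-cong (⊕-comm (a · q) (b · p)) ≋-refl)
      (⊕-assoc (b · p) (a · q) _))))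

    ⊛-comm : ∀ p q → p ⊛ q ≋ q ⊛ p
    ⊛-comm []      q = ≋-sym (⊛-zeroʳ q)
    ⊛-comm (a ∷ p) q =
      ≋-trans (⊕-cong (≋-refl {a · q}) (∷-cong D.refl (⊛-comm p q)))
              (≋-sym (⊛-∷ q a p))

    ⊛-cong : ∀ {p p′ q q′} → p ≋ p′ → q ≋ q′ → p ⊛ q ≋ p′ ⊛ q′
    ⊛-cong {p} {p′} {q} {q′} e f =
      ≋-trans (⊛-congˡ p f)
      (≋-trans (⊛-comm p q′) (≋-trans (⊛-congˡ q′ e) (⊛-comm q′ p′)))

    ⊛-distribʳ : ∀ p q r → (q ⊕ r) ⊛ p ≋ q ⊛ p ⊕ r ⊛ p
    ⊛-distribʳ p q r =
      ≋-trans (⊛-comm (q ⊕ r) p)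
      (≋-trans (⊛-distribˡ p q r) (⊕-cong (⊛-comm p q) (⊛-comm p r)))

    ·-⊛ : ∀ a p q → (a · p) ⊛ q ≋ a · (p ⊛ q)
    ·-⊛ a []      q = ≋-refl
    ·-⊛ a (b ∷ p) q =
      ≋-trans
        (⊕-cong (≋-sym (·-assoc a b q))
                (∷-cong (D.sym (D.zeroʳ a)) (·-⊛ a p q)))
        (≋-sym (·-distrib-⊕ a (b · q) _))

    shift-⊛ : ∀ p q → (D.0# ∷ p) ⊛ q ≋ D.0# ∷ p ⊛ q
    shift-⊛ p q = ⊕-cong (·-zeroˡ q D.refl) ≋-refl

    ⊛-assoc : ∀ p q r → (p ⊛ q) ⊛ r ≋ p ⊛ (q ⊛ r)
    ⊛-assoc []      q r = ≋-refl
    ⊛-assoc (a ∷ p) q r =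
      ≋-trans (⊛-distribʳ r (a · q) _)
        (⊕-cong (·-⊛ a q r)
                (≋-trans (shift-⊛ (p ⊛ q) r) (∷-cong D.refl (⊛-assoc p q r))))

    ⊛-identityˡ : ∀ p → constant D.1# ⊛ p ≋ p
    ⊛-identityˡ p =
      ≋-trans (⊕-cong (·-identityˡ p) shift-[]) (⊕-identityʳ p)

    _≋?[] : ∀ p → Dec (p ≋ [])
    []      ≋?[] = yes ≋-refl
    (a ∷ p) ≋?[] with a D.≈? D.0# | p ≋?[]
    ... | yes e | yes f = yes (∷≋[] e f)
    ... | no ¬e | _     = no λ e → ¬e (at e 0)
    ... | yes _ | no ¬f = no λ e → ¬f (tail≋[] e)

    _≋?_ : Decidable _≋_
    []      ≋? q       = map′ ≋-sym ≋-sym (q ≋?[])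
    (a ∷ p) ≋? []      = (a ∷ p) ≋?[]
    (a ∷ p) ≋? (b ∷ q) with a D.≈? b | p ≋? q
    ... | yes e | yes f = yes (∷-cong e f)
    ... | no ¬e | _     = no λ e → ¬e (at e 0)
    ... | yes _ | no ¬f = no λ e → ¬f (coeffs (at e ∘ suc))

    ⊛-noZeroDivisors : ∀ p q → p ⊛ q ≋ [] → p ≋ [] ⊎ q ≋ []
    ⊛-noZeroDivisors []      q e = inj₁ ≋-refl
    ⊛-noZeroDivisors (a ∷ p) q e with a D.≈? D.0#
    ⊛-noZeroDivisors (a ∷ p) q e | yes a≈0
      with ⊛-noZeroDivisors p q (tail≋[] (≋-trans (≋-sym (⊕-cong (·-zeroˡ q a≈0) ≋-refl)) e))
    ... | inj₁ p≋[] = inj₁ (∷≋[] a≈0 p≋[])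
    ... | inj₂ q≋[] = inj₂ q≋[]
    ⊛-noZeroDivisors (a ∷ p) []      e | no a≉0 = inj₂ ≋-refl
    ⊛-noZeroDivisors (a ∷ p) (b ∷ q) e | no a≉0
      with D.noZeroDivisors a b (D.trans (D.sym (D.+-identityʳ _)) (at e 0))
    ... | inj₁ a≈0 = contradiction a≈0 a≉0
    ... | inj₂ b≈0
      with ⊛-noZeroDivisors (a ∷ p) q
             (tail≋[] (≋-trans (≋-sym (⊕-cong (·-zeroˡ (a ∷ p) b≈0) ≋-refl))
                      (≋-trans (≋-sym (⊛-∷ (a ∷ p) b q)) e)))
    ...   | inj₁ p≋[] = inj₁ p≋[]
    ...   | inj₂ q≋[] = inj₂ (∷≋[] b≈0 q≋[])

  commutativeRing : CommutativeRing c ℓ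
  commutativeRing = record
    { Carrier = Poly ; _≈_ = _≋_ ; _+_ = _⊕_ ; _*_ = _⊛_ ; -_ = ⊖_
    ; 0# = [] ; 1# = constant D.1#
    ; isCommutativeRing = record
      { isRing = record
        { +-isAbelianGroup = record
          { isGroup = record
            { isMonoid = record
              { isSemigroup = record
                { isMagma = record
                  { isEquivalence = record
                    { refl = ≋-refl ; sym = ≋-sym ; trans = ≋-trans }
                  ; ∙-cong = ⊕-cong }
                ; assoc = ⊕-assoc }
              ; identity = (λ _ → ≋-refl) , ⊕-identityʳ }
            ; inverse = ⊖-inverseˡ , ⊖-inverseʳ
            ; ⁻¹-cong = ⊖-cong }
          ; comm = ⊕-comm }
        ; *-cong = ⊛-cong
        ; *-assoc = ⊛-assoc
        ; *-identity = ⊛-identityˡ , λ p → ≋-trans (⊛-comm p (constant D.1#)) (⊛-identityˡ p)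
        ; distrib = ⊛-distribˡ , ⊛-distribʳ }
      ; *-comm = ⊛-comm } }

  domain : IntegralDomain c ℓ
  domain = record
    { commutativeRing = commutativeRing
    ; _≈?_            = _≋?_
    ; 1≉0             = λ e → D.1≉0 (at e 0)
    ; noZeroDivisors  = ⊛-noZeroDivisors
    }

module RingIdentities {c ℓ} (R : CommutativeRing c ℓ) where

  open CommutativeRing R using (_≈_; _+_; _*_; refl; commutativeSemiring)
  open SemiringSolver commutativeSemiring using (solve; _:=_; _:+_; _:*_)

  ≃-trans-l₁ : ∀ d a f → d * (a * f) ≈ a * d * f
  ≃-trans-l₁ = solve 3 (λ d a f → d :* (a :* f) := a :* d :* f) refl

  ≃-trans-l₂ : ∀ c b f → c * b * f ≈ c * f * b
  ≃-trans-l₂ = solve 3 (λ c b f → c :* b :* f := c :* f :* b) refl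

  ≃-trans-l₃ : ∀ e d b → e * d * b ≈ d * (e * b)
  ≃-trans-l₃ = solve 3 (λ e d b → e :* d :* b := d :* (e :* b)) refl

  ⊞-cong-l : ∀ a b c d b′ d′ → (a * d + c * b) * (b′ * d′)
    ≈ (a * b′) * (d * d′) + (c * d′) * (b * b′)
  ⊞-cong-l = solve 6 (λ a b c d b′ d′ →
    (a :* d :+ c :* b) :* (b′ :* d′) :=
    (a :* b′) :* (d :* d′) :+ (c :* d′) :* (b :* b′)) refl

  ⊞-cong-r : ∀ a′ b′ c′ d′ b d → (a′ * b) * (d * d′) + (c′ * d) * (b * b′)
    ≈ (a′ * d′ + c′ * b′) * (b * d)
  ⊞-cong-r = solve 6 (λ a′ b′ c′ d′ b d →
    (a′ :* b) :* (d :* d′) :+ (c′ :* d) :* (b :* b′) :=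
    (a′ :* d′ :+ c′ :* b′) :* (b :* d)) refl

  ⊠-cong-l : ∀ a c b d → (a * c) * (b * d) ≈ (a * b) * (c * d)
  ⊠-cong-l = solve 4 (λ a c b d → (a :* c) :* (b :* d) := (a :* b) :* (c :* d)) refl

  ⊞-assoc-lemma : ∀ a b c d e f →
    ((a * d + c * b) * f + e * (b * d)) * (b * (d * f)) ≈
    (a * (d * f) + (c * f + e * d) * b) * (b * d * f)
  ⊞-assoc-lemma = solve 6 (λ a b c d e f →
    ((a :* d :+ c :* b) :* f :+ e :* (b :* d)) :* (b :* (d :* f)) :=
    (a :* (d :* f) :+ (c :* f :+ e :* d) :* b) :* (b :* d :* f)) refl

  ⊞-comm-lemma : ∀ a b c d →
    (a * d + c * b) * (d * b) ≈ (c * b + a * d) * (b * d)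
  ⊞-comm-lemma = solve 4 (λ a b c d →
    (a :* d :+ c :* b) :* (d :* b) :=
    (c :* b :+ a :* d) :* (b :* d)) refl

  ⊠-distribˡ-lemma : ∀ a b c d e f →
    (a * (c * f + e * d)) * ((b * d) * (b * f)) ≈
    (a * c * (b * f) + a * e * (b * d)) * (b * (d * f))
  ⊠-distribˡ-lemma = solve 6 (λ a b c d e f →
    (a :* (c :* f :+ e :* d)) :* ((b :* d) :* (b :* f)) :=
    (a :* c :* (b :* f) :+ a :* e :* (b :* d)) :* (b :* (d :* f))) refl

module FieldOfFractions {c ℓ} (D : IntegralDomain c ℓ) where

  private
    module D = IntegralDomain D
    open D using (_≈_; 0#; 1#) renaming (_+_ to _+ᴰ_; _*_ to _*ᴰ_; -_ to -ᴰ_)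
    open RingProperties D.ring using (-‿distribˡ-*; x[y-z]≈xy-xz)
    open GroupProperties D.+-group using ()
      renaming (x≈y⇒x∙y⁻¹≈ε to x≈y⇒x-y≈0; x∙y⁻¹≈ε⇒x≈y to x-y≈0⇒x≈y)
    open RingIdentities D.commutativeRing

  infix 6 _/_∵_
  record Fraction : Set (c ⊔ ℓ) where
    constructor _/_∵_
    field
      num   : D.Carrier
      den   : D.Carrier
      den≉0 : ¬ den ≈ 0#
  open Fraction public

  infix 4 _≃_
  record _≃_ (p q : Fraction) : Set ℓ where
    constructor cross
    field uncross : num p *ᴰ den q ≈ num q *ᴰ den p
  open _≃_ public

  private
    *-nonZero : ∀ {a b} → ¬ a ≈ 0# → ¬ b ≈ 0# → ¬ a *ᴰ b ≈ 0#
    *-nonZero {a} {b} a≉0 b≉0 e with D.noZeroDivisors a b e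
    ... | inj₁ a≈0 = a≉0 a≈0
    ... | inj₂ b≈0 = b≉0 b≈0

  infixl 6 _⊞_
  infixl 7 _⊠_

  _⊞_ : Fraction → Fraction → Fraction
  (a / b ∵ b≉0) ⊞ (c / d ∵ d≉0) = (a *ᴰ d +ᴰ c *ᴰ b) / b *ᴰ d ∵ *-nonZero b≉0 d≉0

  _⊠_ : Fraction → Fraction → Fraction
  (a / b ∵ b≉0) ⊠ (c / d ∵ d≉0) = a *ᴰ c / b *ᴰ d ∵ *-nonZero b≉0 d≉0

  ⊟_ : Fraction → Fraction
  ⊟ (a / b ∵ b≉0) = (-ᴰ a) / b ∵ b≉0

  embed : D.Carrier → Fraction
  embed a = a / 1# ∵ D.1≉0

  private
    cancel : ∀ {a b c} → ¬ a ≈ 0# → a *ᴰ b ≈ a *ᴰ c → b ≈ c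
    cancel {a} {b} {c} a≉0 e with D.noZeroDivisors a (b +ᴰ -ᴰ c)
      (D.trans (x[y-z]≈xy-xz a b c) (x≈y⇒x-y≈0 e))
    ... | inj₁ a≈0   = contradiction a≈0 a≉0
    ... | inj₂ b-c≈0 = x-y≈0⇒x≈y b c b-c≈0

    ≃-refl : ∀ {p} → p ≃ p
    ≃-refl = cross D.refl

    ≃-sym : ∀ {p q} → p ≃ q → q ≃ p
    ≃-sym (cross e) = cross (D.sym e)

    ≃-trans : ∀ {p q r} → p ≃ q → q ≃ r → p ≃ r
    ≃-trans {a / b ∵ _} {c / d ∵ d≉0} {e / f ∵ _} (cross u) (cross v) =
      cross (cancel d≉0 (begin
        d *ᴰ (a *ᴰ f)  ≈⟨ ≃-trans-l₁ d a f ⟩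
        a *ᴰ d *ᴰ f    ≈⟨ D.*-congʳ u ⟩
        c *ᴰ b *ᴰ f    ≈⟨ ≃-trans-l₂ c b f ⟩
        c *ᴰ f *ᴰ b    ≈⟨ D.*-congʳ v ⟩
        e *ᴰ d *ᴰ b    ≈⟨ ≃-trans-l₃ e d b ⟩
        d *ᴰ (e *ᴰ b)  ∎))
      where
      open SetoidReasoning D.setoid

    ⊞-cong : ∀ {p p′ q q′} → p ≃ p′ → q ≃ q′ → p ⊞ q ≃ p′ ⊞ q′
    ⊞-cong {a / b ∵ _} {a′ / b′ ∵ _} {c / d ∵ _} {c′ / d′ ∵ _} (cross u) (cross v) =
      cross (begin
        (a *ᴰ d +ᴰ c *ᴰ b) *ᴰ (b′ *ᴰ d′)                       ≈⟨ ⊞-cong-l a b c d b′ d′ ⟩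
        (a *ᴰ b′) *ᴰ (d *ᴰ d′) +ᴰ (c *ᴰ d′) *ᴰ (b *ᴰ b′)       ≈⟨ D.+-cong (D.*-congʳ u) (D.*-congʳ v) ⟩
        (a′ *ᴰ b) *ᴰ (d *ᴰ d′) +ᴰ (c′ *ᴰ d) *ᴰ (b *ᴰ b′)       ≈⟨ ⊞-cong-r a′ b′ c′ d′ b d ⟩
        (a′ *ᴰ d′ +ᴰ c′ *ᴰ b′) *ᴰ (b *ᴰ d)                     ∎)
      where
      open SetoidReasoning D.setoid

    ⊠-cong : ∀ {p p′ q q′} → p ≃ p′ → q ≃ q′ → p ⊠ q ≃ p′ ⊠ q′
    ⊠-cong {a / b ∵ _} {a′ / b′ ∵ _} {c / d ∵ _} {c′ / d′ ∵ _} (cross u) (cross v) =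
      cross (begin
        (a *ᴰ c) *ᴰ (b′ *ᴰ d′)  ≈⟨ ⊠-cong-l a c b′ d′ ⟩
        (a *ᴰ b′) *ᴰ (c *ᴰ d′)  ≈⟨ D.*-cong u v ⟩
        (a′ *ᴰ b) *ᴰ (c′ *ᴰ d)  ≈⟨ ⊠-cong-l a′ b c′ d ⟩
        (a′ *ᴰ c′) *ᴰ (b *ᴰ d)  ∎)
      where
      open SetoidReasoning D.setoid

    ⊟-cong : ∀ {p q} → p ≃ q → ⊟ p ≃ ⊟ q
    ⊟-cong {a / b ∵ _} {c / d ∵ _} (cross u) = cross
      (D.trans (D.sym (-‿distribˡ-* a d)) (D.trans (D.-‿cong u) (-‿distribˡ-* c b)))

    ⊞-assoc : ∀ p q r → (p ⊞ q) ⊞ r ≃ p ⊞ (q ⊞ r)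
    ⊞-assoc (a / b ∵ _) (c / d ∵ _) (e / f ∵ _) = cross (⊞-assoc-lemma a b c d e f)

    ⊞-comm : ∀ p q → p ⊞ q ≃ q ⊞ p
    ⊞-comm (a / b ∵ _) (c / d ∵ _) = cross (⊞-comm-lemma a b c d)

    ⊞-identityˡ : ∀ p → embed 0# ⊞ p ≃ p
    ⊞-identityˡ (a / b ∵ _) = cross (D.trans
      (D.*-congʳ (D.trans (D.+-cong (D.zeroˡ b) (D.*-identityʳ a)) (D.+-identityˡ a)))
      (D.*-congˡ (D.sym (D.*-identityˡ b))))

    ⊟-inverseˡ : ∀ p → ⊟ p ⊞ p ≃ embed 0#
    ⊟-inverseˡ (a / b ∵ _) = cross (D.trans (D.*-identityʳ _)
      (D.trans (D.sym (D.distribʳ b (-ᴰ a) a))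
      (D.trans (D.*-congʳ (D.-‿inverseˡ a))
      (D.trans (D.zeroˡ b) (D.sym (D.zeroˡ _))))))

    ⊠-assoc : ∀ p q r → (p ⊠ q) ⊠ r ≃ p ⊠ (q ⊠ r)
    ⊠-assoc (a / b ∵ _) (c / d ∵ _) (e / f ∵ _) =
      cross (D.*-cong (D.*-assoc a c e) (D.sym (D.*-assoc b d f)))

    ⊠-comm : ∀ p q → p ⊠ q ≃ q ⊠ p
    ⊠-comm (a / b ∵ _) (c / d ∵ _) = cross (D.*-cong (D.*-comm a c) (D.*-comm d b))

    ⊠-identityˡ : ∀ p → embed 1# ⊠ p ≃ p
    ⊠-identityˡ (a / b ∵ _) =
      cross (D.*-cong (D.*-identityˡ a) (D.sym (D.*-identityˡ b)))

    ⊠-distribˡ : ∀ p q r → p ⊠ (q ⊞ r) ≃ p ⊠ q ⊞ p ⊠ r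
    ⊠-distribˡ (a / b ∵ _) (c / d ∵ _) (e / f ∵ _) = cross (⊠-distribˡ-lemma a b c d e f)

    ⊠-distribʳ : ∀ p q r → (q ⊞ r) ⊠ p ≃ q ⊠ p ⊞ r ⊠ p
    ⊠-distribʳ p q r = ≃-trans (⊠-comm (q ⊞ r) p)
      (≃-trans (⊠-distribˡ p q r) (⊞-cong (⊠-comm p q) (⊠-comm p r)))

    _≃?_ : Decidable _≃_
    p ≃? q = map′ cross uncross (_ D.≈? _)

  commutativeRing : CommutativeRing (c ⊔ ℓ) ℓ
  commutativeRing = record
    { Carrier = Fraction ; _≈_ = _≃_ ; _+_ = _⊞_ ; _*_ = _⊠_ ; -_ = ⊟_
    ; 0# = embed 0# ; 1# = embed 1#
    ; isCommutativeRing = record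
      { isRing = record
        { +-isAbelianGroup = record
          { isGroup = record
            { isMonoid = record
              { isSemigroup = record
                { isMagma = record
                  { isEquivalence = record
                    { refl = ≃-refl ; sym = ≃-sym ; trans = ≃-trans }
                  ; ∙-cong = ⊞-cong }
                ; assoc = ⊞-assoc }
              ; identity = ⊞-identityˡ , λ p → ≃-trans (⊞-comm p (embed 0#)) (⊞-identityˡ p) }
            ; inverse = ⊟-inverseˡ , λ p → ≃-trans (⊞-comm p (⊟ p)) (⊟-inverseˡ p)
            ; ⁻¹-cong = ⊟-cong }
          ; comm = ⊞-comm }
        ; *-cong = ⊠-cong
        ; *-assoc = ⊠-assoc
        ; *-identity = ⊠-identityˡ , λ p → ≃-trans (⊠-comm p (embed 1#)) (⊠-identityˡ p)
        ; distrib = ⊠-distribˡ , ⊠-distribʳ }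
      ; *-comm = ⊠-comm } }

  private
    module F = CommutativeRing commutativeRing
    open GroupProperties F.+-group using ()
      renaming (x≈y⇒x∙y⁻¹≈ε to p≃q⇒p-q≃0; x∙y⁻¹≈ε⇒x≈y to p-q≃0⇒p≃q)

    0≄1 : ¬ F.0# ≃ F.1#
    0≄1 (cross e) = D.1≉0 (D.trans (D.sym (D.*-identityʳ 1#))
      (D.trans (D.sym e) (D.zeroˡ 1#)))

    num≉0 : ∀ {p} → ¬ p ≃ F.0# → ¬ num p ≈ 0#
    num≉0 p≄0 e = p≄0 (cross (D.trans (D.*-identityʳ _) (D.trans e (D.sym (D.zeroˡ _)))))

    inverse : ∀ p → ¬ p ≃ F.0# → ∃ λ q → q ⊠ p ≃ F.1# × p ⊠ q ≃ F.1#
    inverse p@(a / b ∵ b≉0) p≄0 = q , ≃-trans (⊠-comm q p) p⊠q≃1 , p⊠q≃1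
      where
      q : Fraction
      q = b / a ∵ num≉0 p≄0
      p⊠q≃1 : p ⊠ q ≃ F.1#
      p⊠q≃1 = cross (D.trans (D.*-identityʳ _) (D.trans (D.*-comm a b) (D.sym (D.*-identityˡ _))))

  heytingField : HeytingField (c ⊔ ℓ) ℓ ℓ
  heytingField = record
    { _≈_ = _≃_ ; _#_ = λ p q → ¬ p ≃ q
    ; _+_ = _⊞_ ; _*_ = _⊠_ ; -_ = ⊟_ ; 0# = F.0# ; 1# = F.1#
    ; isHeytingField = record
      { isHeytingCommutativeRing = record
        { isCommutativeRing = F.isCommutativeRing
        ; isApartnessRelation = record
          { irrefl  = λ p≃q p≄q → p≄q p≃q
          ; sym     = λ p≄q q≃p → p≄q (≃-sym q≃p)
          ; cotrans = cotrans }
        ; #⇒invertible = λ p≄q → inverse _ (p≄q ∘ p-q≃0⇒p≃q _ _)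
        ; invertible⇒# = λ (r , r⊠[p-q]≃1 , _) p≃q → 0≄1 (≃-trans
            (≃-sym (≃-trans (F.*-congˡ {r} (p≃q⇒p-q≃0 p≃q)) (F.zeroʳ r))) r⊠[p-q]≃1) }
      ; tight = λ p q → decidable-stable (p ≃? q) , λ p≃q p≄q → p≄q p≃q } }
    where
    cotrans : ∀ {p q} → ¬ p ≃ q → ∀ r → (¬ p ≃ r) ⊎ (¬ r ≃ q)
    cotrans {p} {q} p≄q r with p ≃? r
    ... | yes p≃r = inj₂ λ r≃q → p≄q (≃-trans p≃r r≃q)
    ... | no  p≄r = inj₁ p≄r

module ℤ[x] = Polynomial ℤ-domain
module ℤ[x][y] = Polynomial ℤ[x].domain

module ℤ[x,y] = IntegralDomain ℤ[x][y].domain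

-- The field of fractions of ℤ[x,y] is that of ℚ[x,y].

module ℚ⟨x,y⟩ where
  open FieldOfFractions ℤ[x][y].domain public
    using (Fraction; _/_∵_; embed; commutativeRing; heytingField)
  open HeytingField heytingField public
  open Exp (CommutativeRing.semiring commutativeRing) public using (_^_)

x y : ℤ[x,y].Carrier
x = ℤ[x][y].constant ℤ[x].variable-X
y = ℤ[x][y].variable-X

x-1≉0 : ¬ (x ℤ[x,y].- ℤ[x,y].1#) ℤ[x,y].≈ ℤ[x,y].0#
x-1≉0 e with ℤ[x].at (ℤ[x][y].at e 0) 0
... | ()

record Graph : Set where
  field
    #V   : ℕ
    #E   : ℕ
    ends : Vec (Fin #V × Fin #V) #E

-- A spanning subgraph keeps all vertices, so it is given by its edge set.

SpanningSubgraph : Graph → Set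
SpanningSubgraph G = Subset (Graph.#E G)

Adjacent : ∀ {v e} → Vec (Fin v × Fin v) e → Subset e → Rel (Fin v) 0ℓ
Adjacent ends H u w = ∃ λ i → i ∈ H × lookup ends i ≡ (u , w)

-- An enumeration without repetition of the classes of the equivalence
-- relation generated by _~_.

record Components {v} (_~_ : Rel (Fin v) 0ℓ) : Set where
  field
    number     : ℕ
    class      : Fin v → Fin number
    surjective : StrictlySurjective _≡_ class
    class≡     : ∀ u w → class u ≡ class w ⇔ EqClosure _~_ u w

private

  Components-resp : ∀ {v} {R S : Rel (Fin v) 0ℓ} →
                    R ⇒ S → S ⇒ EqClosure R → Components R → Components S
  Components-resp R⇒S S⇒R C = record
    { number = number ; class = class ; surjective = surjective
    ; class≡ = λ u w → mk⇔
        (λ eq → EqClosure.map R⇒S (Equivalence.to (class≡ u w) eq))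
        (λ u∼w → Equivalence.from (class≡ u w) ((S⇒R EqClosure.⋆) u∼w)) }
    where
    open Components C

  module Collapse {k} (i j : Fin (suc k)) (i≢j : i ≢ j) where

    collapse : Fin (suc k) → Fin k
    collapse c with i ≟ᶠ c
    ... | yes _  = punchOut i≢j
    ... | no i≢c = punchOut i≢c

    collapse-i≡collapse-j : collapse i ≡ collapse j
    collapse-i≡collapse-j with i ≟ᶠ i | i ≟ᶠ j
    ... | no i≢i | _       = contradiction ≡.refl i≢i
    ... | yes _  | yes i≡j = contradiction i≡j i≢j
    ... | yes _  | no _    = punchOut-cong i ≡.refl

    collapse-surjective : StrictlySurjective _≡_ collapse
    collapse-surjective c = punchIn i c , lemma
      where
      lemma : collapse (punchIn i c) ≡ c
      lemma with i ≟ᶠ punchIn i c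
      ... | yes i≡ = contradiction (≡.sym i≡) (punchInᵢ≢i i c)
      ... | no  _  = ≡.trans (punchOut-cong i ≡.refl) (punchOut-punchIn i)

    collapse-kernel : ∀ c d → collapse c ≡ collapse d →
                      c ≡ d ⊎ (c ≡ i × d ≡ j) ⊎ (c ≡ j × d ≡ i)
    collapse-kernel c d eq with i ≟ᶠ c | i ≟ᶠ d
    ... | yes i≡c | yes i≡d = inj₁ (≡.trans (≡.sym i≡c) i≡d)
    ... | yes i≡c | no  i≢d = inj₂ (inj₁ (≡.sym i≡c , ≡.sym (punchOut-injective i≢j i≢d eq)))
    ... | no  i≢c | yes i≡d = inj₂ (inj₂ (punchOut-injective i≢c i≢j eq , ≡.sym i≡d))
    ... | no  i≢c | no  i≢d = inj₁ (punchOut-injective i≢c i≢d eq)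

  Components-add : ∀ {v} {R S : Rel (Fin v) 0ℓ} a b →
                   R ⇒ S → S a b → (∀ {u w} → S u w → R u w ⊎ (u ≡ a × w ≡ b)) →
                   Components R → Components S
  Components-add {R = R} {S} a b R⇒S Sab S⇒R C
    with Components.class C a ≟ᶠ Components.class C b
  ... | yes eq = Components-resp R⇒S step C
    where
    open Components C
    step : S ⇒ EqClosure R
    step Suw with S⇒R Suw
    ... | inj₁ Ruw               = EqClosure.return Ruw
    ... | inj₂ (≡.refl , ≡.refl) = Equivalence.to (class≡ a b) eq
  ... | no neq = merge C neq
    where
    merge : (C : Components R) → Components.class C a ≢ Components.class C b → Components S
    merge record { number = zero ; class = class } _ = contradiction (class a) λ ()
    merge record { number = suc k ; class = class ; surjective = surj ; class≡ = class≡ } neq =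
      record
        { number     = k
        ; class      = collapse ∘ class
        ; surjective = λ c →
            let d , d≡ = collapse-surjective c
                u , u≡ = surj d
            in u , ≡.trans (≡.cong collapse u≡) d≡
        ; class≡     = λ u w → mk⇔ (sound u w)
            (EqClosure.fold (On.isEquivalence (collapse ∘ class) ≡.isEquivalence) step)
        }
      where
      open Collapse (class a) (class b) neq

      inR : ∀ u w → class u ≡ class w → EqClosure S u w
      inR u w eq = EqClosure.map R⇒S (Equivalence.to (class≡ u w) eq)

      sound : ∀ u w → collapse (class u) ≡ collapse (class w) → EqClosure S u w
      sound u w eq with collapse-kernel (class u) (class w) eq
      ... | inj₁ u≡w               = inR u w u≡w
      ... | inj₂ (inj₁ (u≡a , w≡b)) =
        EqClosure.transitive S (inR u a u≡a)
          (EqClosure.transitive S (EqClosure.return Sab) (inR b w (≡.sym w≡b)))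
      ... | inj₂ (inj₂ (u≡b , w≡a)) =
        EqClosure.symmetric S (EqClosure.transitive S (inR w a w≡a)
          (EqClosure.transitive S (EqClosure.return Sab) (inR b u (≡.sym u≡b))))

      step : ∀ {u w} → S u w → collapse (class u) ≡ collapse (class w)
      step {u} {w} Suw with S⇒R Suw
      ... | inj₁ Ruw = ≡.cong collapse (Equivalence.from (class≡ u w) (EqClosure.return Ruw))
      ... | inj₂ (≡.refl , ≡.refl) = collapse-i≡collapse-j

components : ∀ {v e} (ends : Vec (Fin v × Fin v) e) (H : Subset e) →
             Components (Adjacent ends H)
components {v} [] [] = record
  { number     = v
  ; class      = id
  ; surjective = λ u → u , ≡.refl
  ; class≡     = λ u w → mk⇔ (λ { ≡.refl → EqClosure.reflexive _ })
                             (EqClosure.fold ≡.isEquivalence λ { (() , _) })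
  }
components (_ ∷ ends) (outside ∷ H) = Components-resp
  (λ (i , i∈H , eq) → suc i , there i∈H , eq)
  (λ { (suc i , there i∈H , eq) → EqClosure.return (i , i∈H , eq) })
  (components ends H)
components ((a , b) ∷ ends) (inside ∷ H) = Components-add a b
  (λ (i , i∈H , eq) → suc i , there i∈H , eq)
  (zero , here , ≡.refl)
  (λ { (zero  , here      , ≡.refl) → inj₂ (≡.refl , ≡.refl)
     ; (suc i , there i∈H , eq)     → inj₁ (i , i∈H , eq) })
  (components ends H)

module _ (G : Graph) where

  open Graph G

  Connected : SpanningSubgraph G → Rel (Fin #V) 0ℓ
  Connected H = EqClosure (Adjacent ends H)

  connected? : ∀ u w (H : SpanningSubgraph G) → Dec (Connected H u w)
  connected? u w H = map′ (Equivalence.to (class≡ u w)) (Equivalence.from (class≡ u w))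
                          (class u ≟ᶠ class w)
    where open Components (components ends H)

  k : SpanningSubgraph G → ℕ
  k H = Components.number (components ends H)

  -- Since k H ≤ #V, and k H decreases by at most one with each added edge,
  -- none of the truncated subtractions below (including those in the
  -- exponents of tutteTerm) ever truncates.

  rank : SpanningSubgraph G → ℕ
  rank H = #V ∸ k H

  nullity : SpanningSubgraph G → ℕ
  nullity H = ∣ H ∣ ∸ rank H

  module _ where
    open ℤ[x,y]
    open Exp semiring using (_^_)

    tutteTerm : SpanningSubgraph G → ℤ[x,y].Carrier
    tutteTerm H = (x - 1#) ^ (rank ⊤ ∸ rank H) * (y - 1#) ^ nullity H

    sumTerms : List (SpanningSubgraph G) → ℤ[x,y].Carrier
    sumTerms = foldr (λ H s → tutteTerm H + s) 0#

allSubsets : ∀ n → List (Subset n)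
allSubsets zero    = [] ∷ []
allSubsets (suc n) = map (outside ∷_) (allSubsets n) ++ map (inside ∷_) (allSubsets n)

spanningSubgraphs : (G : Graph) → List (SpanningSubgraph G)
spanningSubgraphs G = allSubsets (Graph.#E G)

tutte : Graph → ℤ[x,y].Carrier
tutte G = sumTerms G (spanningSubgraphs G)

-- A graph with two special vertices, the first of which is vertex 0.

record MarkedGraph : Set where
  field
    #V-1  : ℕ
    #E    : ℕ
    ends  : Vec (Fin (suc #V-1) × Fin (suc #V-1)) #E
    Y     : Fin (suc #V-1)

  X : Fin (suc #V-1)
  X = zero

  graph : Graph
  graph = record { #V = suc #V-1 ; #E = #E ; ends = ends }

-- The vertices of the result are those of A followed by those of B other
-- than its X, which is identified with the Y of A.

module Glue (A B : MarkedGraph) where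

  private
    module A = MarkedGraph A
    module B = MarkedGraph B

  left : Fin (suc A.#V-1) → Fin (suc (A.#V-1 +ℕ B.#V-1))
  left u = u ↑ˡ B.#V-1

  right : Fin (suc B.#V-1) → Fin (suc (A.#V-1 +ℕ B.#V-1))
  right zero    = left A.Y
  right (suc u) = suc A.#V-1 ↑ʳ u

  glue : MarkedGraph
  glue = record
    { #V-1 = A.#V-1 +ℕ B.#V-1
    ; #E   = suc (A.#E +ℕ B.#E)
    ; ends = (left A.X , right B.Y)
             ∷ Vec.map (Product.map left left) A.ends
               Vec.++ Vec.map (Product.map right right) B.ends
    ; Y    = right B.Y
    }

open Glue using (glue)

farey : ℕ → MarkedGraph
farey zero    = record { #V-1 = 1 ; #E = 1 ; ends = (zero , suc zero) ∷ [] ; Y = suc zero }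
farey (suc n) = glue (farey n) (farey n)

module _ (n : ℕ) where

  open MarkedGraph (farey n)

  G₁ G₂ : List (SpanningSubgraph graph)
  G₁ = filter (connected? graph X Y) (spanningSubgraphs graph)
  G₂ = filter (λ H → ¬? (connected? graph X Y H)) (spanningSubgraphs graph)

  T T₁ T₂ : ℤ[x,y].Carrier
  T  = tutte graph
  T₁ = sumTerms graph G₁
  T₂ = sumTerms graph G₂

-- A spanning subgraph of the glued graph is a pair (G, H) of spanning subgraphs
-- of the two halves, with or without the new edge.  Without it, contracting
-- either half to the shared vertex shows that connectedness inside a half is not
-- affected by the other, so k = k(G) + k(H) - 1, the term of the union is the
-- product of the two terms, and the special vertices are joined iff they are in
-- both halves.  Adding the new edge raises the nullity by one if they were
-- already joined, and otherwise lowers k, dividing the term by x - 1.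

module Submission where

open import Defs
open import Algebra.Bundles using (CommutativeRing)
import Algebra.Properties.AbelianGroup as AbelianGroupProperties
import Algebra.Properties.CommutativeSemigroup as CommutativeSemigroupProperties
import Algebra.Properties.Semiring.Exp as Exp
import Algebra.Solver.Ring.NaturalCoefficients.Default as SemiringSolver
open import Data.Bool.Base using (true; false; if_then_else_)
open import Data.Fin.Base using (Fin; zero; suc; splitAt)
open import Data.Fin.Properties using (splitAt-↑ˡ; splitAt-↑ʳ) renaming (_≟_ to _≟ᶠ_)
open import Data.Fin.Subset using (Subset; inside; outside; ⊤; ∣_∣)
open import Data.List.Base as List using (List; []; _∷_; map; filter; foldr)
open import Data.Nat.Base using (ℕ; zero; suc; _∸_; _≤_; z≤n; s≤s) renaming (_+_ to _+ℕ_)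
import Data.Nat.Properties as ℕ
open import Data.Product.Base as Product using (_×_; _,_; proj₁; proj₂)
open import Data.Sum.Base as Sum using (_⊎_; inj₁; inj₂; [_,_]′)
open import Data.Vec.Base as Vec using (Vec; []; _∷_; _++_; here; there)
open import Data.Vec.Properties using (lookup-map)
open import Function.Base using (id; const; _∘_)
open import Function.Bundles using (_⇔_; mk⇔; Equivalence)
open import Level using (0ℓ)
open import Relation.Binary.Construct.Closure.Equivalence as EqClosure using (EqClosure)
open import Relation.Binary.Core using (Rel; _⇒_; _=[_]⇒_)
open import Relation.Binary.PropositionalEquality as ≡
  using (_≡_; cong; cong₂; subst; subst₂; module ≡-Reasoning)
import Relation.Binary.Reasoning.Setoid as SetoidReasoning
open import Relation.Nullary.Decidable using (Dec; yes; no; does; ¬?; dec-true; dec-false)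
open import Relation.Nullary.Negation using (¬_; contradiction)
open import Relation.Unary using (Pred; Decidable)

open Glue using (glue)
open CommutativeSemigroupProperties ℕ.+-commutativeSemigroup using (interchange)

-- Since `x - 1` is not invertible in ℤ[x,y], the recurrence for the joined sum is proved in a form
-- multiplied by `x - 1`, over an arbitrary commutative ring; division takes place only after
-- embedding into the field of fractions. A second obstacle is the truncated subtraction in `rank`
-- and `nullity`: each exponent is first characterised by an equation between sums of naturals,
-- valid because the whole graph has one component, and these equations add up under gluing.
-- Component counts are given by a recursion over the edge list, so the count for a union is
-- obtained by inserting edges one at a time while the vertex sets stay fixed.

Edges : ℕ → ℕ → Set
Edges v e = Vec (Fin v × Fin v) e

mapEdges : ∀ {v w e} → (Fin v → Fin w) → Edges v e → Edges w e
mapEdges f = Vec.map (Product.map f f)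

Linked : ∀ {v e} → Edges v e → Subset e → Rel (Fin v) _
Linked E H = EqClosure (Adjacent E H)

linked? : ∀ {v e} (E : Edges v e) H u w → Dec (Linked E H u w)
linked? {v} {e} E H u w = connected? (record { #V = v ; #E = e ; ends = E }) u w H

#components : ∀ {v e} → Edges v e → Subset e → ℕ
#components E H = Components.number (components E H)

-- Adjacency under prepending, mapping and concatenating edges

module _ {v e} (E : Edges v e) {H : Subset e} where

  Adjacent-suc : ∀ {edge side} → Adjacent E H ⇒ Adjacent (edge ∷ E) (side ∷ H)
  Adjacent-suc (i , i∈H , eq) = suc i , there i∈H , eq

  Adjacent-outside⁻ : ∀ {edge} → Adjacent (edge ∷ E) (outside ∷ H) ⇒ Adjacent E H
  Adjacent-outside⁻ (suc i , there i∈H , eq) = i , i∈H , eq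

  Adjacent-map⁺ : ∀ {w} (f : Fin v → Fin w) → Adjacent E H =[ f ]⇒ Adjacent (mapEdges f E) H
  Adjacent-map⁺ f (i , i∈H , eq) =
    i , i∈H , ≡.trans (lookup-map i _ E) (cong (Product.map f f) eq)

  Adjacent-map⁻ : ∀ {w} (f : Fin v → Fin w) (R : Rel (Fin w) 0ℓ) →
                  Adjacent E H =[ f ]⇒ R → Adjacent (mapEdges f E) H ⇒ R
  Adjacent-map⁻ f R step (i , i∈H , eq)
    with ≡.refl ← ≡.trans (≡.sym (lookup-map i (Product.map f f) E)) eq = step (i , i∈H , ≡.refl)

  Adjacent-++⁺ˡ : ∀ {d} (D : Edges v d) {G} → Adjacent D G ⇒ Adjacent (D ++ E) (G ++ H)
  Adjacent-++⁺ˡ (_ ∷ D) {_ ∷ G} (zero  , here      , eq) = zero , here , eq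
  Adjacent-++⁺ˡ (_ ∷ D) {_ ∷ G} (suc i , there i∈G , eq) =
    let j , j∈ , eq′ = Adjacent-++⁺ˡ D (i , i∈G , eq) in suc j , there j∈ , eq′

  Adjacent-++⁺ʳ : ∀ {d} (D : Edges v d) G → Adjacent E H ⇒ Adjacent (D ++ E) (G ++ H)
  Adjacent-++⁺ʳ []      []      adj = adj
  Adjacent-++⁺ʳ (_ ∷ D) (_ ∷ G) adj =
    let j , j∈ , eq = Adjacent-++⁺ʳ D G adj in suc j , there j∈ , eq

  Adjacent-++⁻ : ∀ {d} (D : Edges v d) G {u w} →
                 Adjacent (D ++ E) (G ++ H) u w → Adjacent D G u w ⊎ Adjacent E H u w
  Adjacent-++⁻ []      []      adj                     = inj₂ adj
  Adjacent-++⁻ (_ ∷ D) (_ ∷ G) (zero  , here    , eq)   = inj₁ (zero , here , eq)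
  Adjacent-++⁻ (_ ∷ D) (_ ∷ G) (suc i , there i∈ , eq) =
    Sum.map₁ (λ (j , j∈ , eq′) → suc j , there j∈ , eq′) (Adjacent-++⁻ D G (i , i∈ , eq))

-- Effect of one edge on the number of components

-- For an included edge, `components` tests whether its ends have equal classes. Repeating that test
-- makes both counts compute, and `class≡` excludes the branch that disagrees with the hypothesis.
#components-linked : ∀ {v e} (E : Edges v e) H {a b} → Linked E H a b →
                     #components ((a , b) ∷ E) (inside ∷ H) ≡ #components E H
#components-linked E H {a} {b} a∼b
  with components E H
... | C with Components.class C a ≟ᶠ Components.class C b
...   | yes _      = ≡.refl
...   | no class≢ = contradiction (Equivalence.from (Components.class≡ C a b) a∼b) class≢

#components-merge : ∀ {v e} (E : Edges v e) H {a b} → ¬ Linked E H a b →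
                    suc (#components ((a , b) ∷ E) (inside ∷ H)) ≡ #components E H
#components-merge E H {a} {b} a≁b
  with components E H
... | C with Components.class C a ≟ᶠ Components.class C b
...   | yes class≡ = contradiction (Equivalence.to (Components.class≡ C a b) class≡) a≁b
-- The merging of two classes is defined by matching on `number`, so the count reduces only once the
-- record is split; with `number` zero there would be no class for `a`.
#components-merge E H {a} {b} a≁b
    | record { number = zero  ; class = class } | no _ = contradiction (class a) λ ()
#components-merge E H {a} {b} a≁b
    | record { number = suc _ } | no _ = ≡.refl

-- An included edge lowers the count by at most one, starting from `v`. The first bound makes the
-- subtraction in `rank` exact, the second the one in `nullity`.
#components-bounds : ∀ {v e} (E : Edges v e) H →
                     #components E H ≤ v × v ≤ ∣ H ∣ +ℕ #components E H
#components-bounds []            []            = ℕ.≤-refl , ℕ.≤-refl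
#components-bounds (_ ∷ E)       (outside ∷ H) = #components-bounds E H
#components-bounds {v} ((a , b) ∷ E) (inside ∷ H)
  with #components-bounds E H | linked? E H a b
... | k≤v , v≤h+k | yes a∼b =
  subst (λ k → k ≤ v × v ≤ suc (∣ H ∣ +ℕ k)) (≡.sym (#components-linked E H a∼b))
    (k≤v , ℕ.m≤n⇒m≤1+n v≤h+k)
... | k≤v , v≤h+k | no a≁b =
  ℕ.≤-trans (ℕ.n≤1+n _) (subst (_≤ _) (≡.sym merge) k≤v) ,
  subst (v ≤_) (≡.trans (cong (∣ H ∣ +ℕ_) (≡.sym merge)) (ℕ.+-suc ∣ H ∣ _)) v≤h+k
  where merge = #components-merge E H a≁b

#components-inside-≤ : ∀ {v e} (E : Edges v e) H {edge} →
                       #components (edge ∷ E) (inside ∷ H) ≤ #components E H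
#components-inside-≤ E H {a , b} with linked? E H a b
... | yes a∼b = ℕ.≤-reflexive (#components-linked E H a∼b)
... | no a≁b  = ℕ.≤-trans (ℕ.n≤1+n _) (ℕ.≤-reflexive (#components-merge E H a≁b))

#components-pos : ∀ {v e} (E : Edges (suc v) e) H → 1 ≤ #components E H
#components-pos E H with components E H
... | record { number = zero ; class = class } = contradiction (class zero) λ ()
... | record { number = suc _ }                = s≤s z≤n

-- Edges whose ends are linked in both graphs or in neither change both counts alike, so the offsets
-- `m` and `n` survive. This is the inductive step of both component counts for glued graphs.
#components-parallel :
  ∀ {v e w f} (E : Edges v e) H (F : Edges w f) I m n {a b c d} →
  Linked E H a b ⇔ Linked F I c d →
  m +ℕ #components E H ≡ n +ℕ #components F I →
  m +ℕ #components ((a , b) ∷ E) (inside ∷ H) ≡ n +ℕ #components ((c , d) ∷ F) (inside ∷ I)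
#components-parallel E H F I m n {a} {b} iff eq with linked? E H a b
... | yes a∼b =
  subst₂ (λ k l → m +ℕ k ≡ n +ℕ l) (≡.sym (#components-linked E H a∼b))
    (≡.sym (#components-linked F I (Equivalence.to iff a∼b))) eq
... | no a≁b = ℕ.suc-injective (begin
  suc (m +ℕ _)           ≡⟨ ℕ.+-suc m _ ⟨
  m +ℕ suc _             ≡⟨ cong (m +ℕ_) (#components-merge E H a≁b) ⟩
  m +ℕ #components E H   ≡⟨ eq ⟩
  n +ℕ #components F I   ≡⟨ cong (n +ℕ_) (#components-merge F I (a≁b ∘ Equivalence.from iff)) ⟨
  n +ℕ suc _             ≡⟨ ℕ.+-suc n _ ⟩
  suc (n +ℕ _)           ∎)
  where open ≡-Reasoning

∣++∣ : ∀ {m n} (G : Subset m) (H : Subset n) → ∣ G ++ H ∣ ≡ ∣ G ∣ +ℕ ∣ H ∣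
∣++∣ []            H = ≡.refl
∣++∣ (inside  ∷ G) H = cong suc (∣++∣ G H)
∣++∣ (outside ∷ G) H = ∣++∣ G H

⊤-++ : ∀ m {n} → ⊤ {m +ℕ n} ≡ ⊤ {m} ++ ⊤ {n}
⊤-++ zero    = ≡.refl
⊤-++ (suc m) = cong (inside ∷_) (⊤-++ m)

-- Connectedness and component counts after gluing at a vertex

module GlueComponents (A B : MarkedGraph) where
  private
    module A = MarkedGraph A
    module B = MarkedGraph B
  open Glue A B using (left; right; glue)

  contractRight : Fin (suc (A.#V-1 +ℕ B.#V-1)) → Fin (suc A.#V-1)
  contractRight v = [ id , const A.Y ]′ (splitAt (suc A.#V-1) v)

  contractLeft : Fin (suc (A.#V-1 +ℕ B.#V-1)) → Fin (suc B.#V-1)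
  contractLeft v = [ const B.X , suc ]′ (splitAt (suc A.#V-1) v)

  contractRight-left : ∀ u → contractRight (left u) ≡ u
  contractRight-left u = cong [ id , const A.Y ]′ (splitAt-↑ˡ (suc A.#V-1) u B.#V-1)

  contractRight-right : ∀ u → contractRight (right u) ≡ A.Y
  contractRight-right zero    = contractRight-left A.Y
  contractRight-right (suc u) = cong [ id , const A.Y ]′ (splitAt-↑ʳ (suc A.#V-1) B.#V-1 u)

  contractLeft-left : ∀ u → contractLeft (left u) ≡ B.X
  contractLeft-left u = cong [ const B.X , suc ]′ (splitAt-↑ˡ (suc A.#V-1) u B.#V-1)

  contractLeft-right : ∀ u → contractLeft (right u) ≡ u
  contractLeft-right zero    = contractLeft-left A.Y
  contractLeft-right (suc u) = cong [ const B.X , suc ]′ (splitAt-↑ʳ (suc A.#V-1) B.#V-1 u)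

  module _ {d e} (D : Edges (suc A.#V-1) d) (E : Edges (suc B.#V-1) e) where

    -- The edge lists are arbitrary rather than those of `A` and `B`, so that induction can remove
    -- edges without touching the vertices.
    union : Edges (suc (A.#V-1 +ℕ B.#V-1)) (d +ℕ e)
    union = mapEdges left D ++ mapEdges right E

    module _ (G : Subset d) (H : Subset e) where

      left-linked⁺ : ∀ {u w} → Linked D G u w → Linked union (G ++ H) (left u) (left w)
      left-linked⁺ = EqClosure.gmap left
        (Adjacent-++⁺ˡ (mapEdges right E) (mapEdges left D) ∘ Adjacent-map⁺ D left)

      right-linked⁺ : ∀ {u w} → Linked E H u w → Linked union (G ++ H) (right u) (right w)
      right-linked⁺ = EqClosure.gmap right
        (Adjacent-++⁺ʳ (mapEdges right E) (mapEdges left D) G ∘ Adjacent-map⁺ E right)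

      -- An edge from `D` returns to itself, and an edge from `E` collapses to the single vertex
      -- `A.Y`, where reflexivity suffices.
      contractRight-linked : Linked union (G ++ H) =[ contractRight ]⇒ Linked D G
      contractRight-linked = EqClosure.gfold (EqClosure.isEquivalence (Adjacent D G)) contractRight
        ([ Adjacent-map⁻ D left R (λ {u} {w} adj → subst₂ (Linked D G)
             (≡.sym (contractRight-left u)) (≡.sym (contractRight-left w)) (EqClosure.return adj))
         , Adjacent-map⁻ E right R (λ {u} {w} _ → subst₂ (Linked D G)
             (≡.sym (contractRight-right u)) (≡.sym (contractRight-right w)) (EqClosure.reflexive _))
         ]′ ∘ Adjacent-++⁻ (mapEdges right E) (mapEdges left D) G)
        where
        R : Rel _ 0ℓ
        R s t = Linked D G (contractRight s) (contractRight t)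

      contractLeft-linked : Linked union (G ++ H) =[ contractLeft ]⇒ Linked E H
      contractLeft-linked = EqClosure.gfold (EqClosure.isEquivalence (Adjacent E H)) contractLeft
        ([ Adjacent-map⁻ D left R (λ {u} {w} _ → subst₂ (Linked E H)
             (≡.sym (contractLeft-left u)) (≡.sym (contractLeft-left w)) (EqClosure.reflexive _))
         , Adjacent-map⁻ E right R (λ {u} {w} adj → subst₂ (Linked E H)
             (≡.sym (contractLeft-right u)) (≡.sym (contractLeft-right w)) (EqClosure.return adj))
         ]′ ∘ Adjacent-++⁻ (mapEdges right E) (mapEdges left D) G)
        where
        R : Rel _ 0ℓ
        R s t = Linked E H (contractLeft s) (contractLeft t)

      left-linked : ∀ u w → Linked union (G ++ H) (left u) (left w) ⇔ Linked D G u w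
      left-linked u w = mk⇔
        (subst₂ (Linked D G) (contractRight-left u) (contractRight-left w) ∘ contractRight-linked)
        left-linked⁺

      right-linked : ∀ u w → Linked union (G ++ H) (right u) (right w) ⇔ Linked E H u w
      right-linked u w = mk⇔
        (subst₂ (Linked E H) (contractLeft-right u) (contractLeft-right w) ∘ contractLeft-linked)
        right-linked⁺

      specials-linked : Linked union (G ++ H) (left A.X) (right B.Y) ⇔
                        (Linked D G A.X A.Y × Linked E H B.X B.Y)
      specials-linked = mk⇔
        (λ l → subst₂ (Linked D G) (contractRight-left A.X) (contractRight-right B.Y)
                 (contractRight-linked l)
             , subst₂ (Linked E H) (contractLeft-left A.X) (contractLeft-right B.Y)
                 (contractLeft-linked l))
        -- The two paths meet because `right B.X` reduces to `left A.Y`.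
        (λ (l , m) → EqClosure.transitive _ (left-linked⁺ l) (right-linked⁺ m))

  -- With no edges from `A`, all its vertices but the shared one stay isolated. The `1` balances the
  -- shared vertex, which the right side counts in both halves. This is the base case of
  -- `#components-union`.
  #components-right : ∀ {e} (E : Edges (suc B.#V-1) e) H →
                      1 +ℕ #components (mapEdges right E) H ≡ suc A.#V-1 +ℕ #components E H
  #components-right []            []            = cong suc (≡.sym (ℕ.+-suc A.#V-1 B.#V-1))
  #components-right (_ ∷ E)       (outside ∷ H) = #components-right E H
  #components-right ((u , w) ∷ E) (inside ∷ H)  =
    #components-parallel (mapEdges right E) H E H 1 (suc A.#V-1)
      -- On an empty first list `union` reduces to `mapEdges right E`.
      (right-linked [] E [] H u w) (#components-right E H)

  -- All edges of `E` are already present when those of `D` are inserted; by `left-linked` each of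
  -- these merges two components of the union exactly when it does so in the left half.
  #components-union : ∀ {d e} (D : Edges (suc A.#V-1) d) (E : Edges (suc B.#V-1) e) G H →
                      suc (#components (union D E) (G ++ H)) ≡ #components D G +ℕ #components E H
  #components-union []            E []            H = #components-right E H
  #components-union (_ ∷ D)       E (outside ∷ G) H = #components-union D E G H
  #components-union ((u , w) ∷ D) E (inside ∷ G)  H = ≡.trans
    (#components-parallel (union D E) (G ++ H) D G 1 (#components E H) (left-linked D E G H u w)
      (≡.trans (#components-union D E G H) (ℕ.+-comm (#components D G) _)))
    (ℕ.+-comm (#components E H) _)

-- Exponents without truncated subtraction

module _ (G : MarkedGraph) where
  open MarkedGraph G

  OneComponent : Set
  OneComponent = k graph ⊤ ≡ 1

  corank : SpanningSubgraph graph → ℕ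
  corank H = rank graph ⊤ ∸ rank graph H

  Joined : SpanningSubgraph graph → Set
  Joined H = Connected graph H X Y

  joined? : Decidable Joined
  joined? = connected? graph X Y

  module _ (one : OneComponent) (H : SpanningSubgraph graph) where

    private
      bounds = #components-bounds ends H

      corank≡ : corank H ≡ k graph H ∸ 1
      corank≡ = begin
        suc #V-1 ∸ k graph ⊤ ∸ (suc #V-1 ∸ k graph H)
          ≡⟨ cong (λ m → suc #V-1 ∸ m ∸ (suc #V-1 ∸ k graph H)) one ⟩
        #V-1 ∸ (suc #V-1 ∸ k graph H)
          -- As `k graph H` is positive, one successor cancels on each side of the inner
          -- subtraction.
          ≡⟨ cong (λ m → #V-1 ∸ (suc #V-1 ∸ m)) (ℕ.m+[n∸m]≡n (#components-pos ends H)) ⟨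
        #V-1 ∸ (#V-1 ∸ (k graph H ∸ 1))
          ≡⟨ ℕ.m∸[m∸n]≡n (ℕ.∸-monoˡ-≤ 1 (proj₁ bounds)) ⟩
        k graph H ∸ 1 ∎
        where open ≡-Reasoning

    suc-corank : suc (corank H) ≡ k graph H
    suc-corank = ≡.trans (cong suc corank≡) (ℕ.m+[n∸m]≡n (#components-pos ends H))

    -- In a connected graph the rank is `#V-1` minus the corank. Moving both to the positive side
    -- leaves an equation whose entries, apart from the effect of the new edge, add up under gluing.
    nullity+#V-1 : nullity graph H +ℕ #V-1 ≡ ∣ H ∣ +ℕ corank H
    nullity+#V-1 = begin
      ∣ H ∣ ∸ r +ℕ #V-1            ≡⟨ cong (∣ H ∣ ∸ r +ℕ_) r+c≡ ⟨
      ∣ H ∣ ∸ r +ℕ (r +ℕ corank H)  ≡⟨ ℕ.+-assoc (∣ H ∣ ∸ r) r _ ⟨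
      ∣ H ∣ ∸ r +ℕ r +ℕ corank H    ≡⟨ cong (_+ℕ corank H) (ℕ.m∸n+n≡m r≤) ⟩
      ∣ H ∣ +ℕ corank H            ∎
      where
      open ≡-Reasoning
      r = rank graph H
      r≤ : r ≤ ∣ H ∣
      r≤ = ℕ.m≤n+o⇒m∸n≤o (suc #V-1) (k graph H)
             (subst (suc #V-1 ≤_) (ℕ.+-comm ∣ H ∣ _) (proj₂ bounds))
      r+c≡ : r +ℕ corank H ≡ #V-1
      r+c≡ = ℕ.suc-injective (begin
        suc (r +ℕ corank H)  ≡⟨ ℕ.+-suc r _ ⟨
        r +ℕ suc (corank H)  ≡⟨ cong (r +ℕ_) suc-corank ⟩
        r +ℕ k graph H       ≡⟨ ℕ.m∸n+n≡m (proj₁ bounds) ⟩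
        suc #V-1            ∎)

-- Exponents of a union with and without the new edge

module GlueExponents (A B : MarkedGraph) (oneA : OneComponent A) (oneB : OneComponent B) where

  private
    module A = MarkedGraph A
    module B = MarkedGraph B
    A∪B = glue A B
    module A∪B = MarkedGraph A∪B
  open GlueComponents A B

  -- The halves alone already form one component, as `1 + 1` counts the component of the shared
  -- vertex twice. The new edge cannot raise the count, and a count is never zero.
  glue-oneComponent : OneComponent A∪B
  glue-oneComponent = ℕ.≤-antisym (begin
    k A∪B.graph ⊤                        ≤⟨ #components-inside-≤ E ⊤ ⟩
    #components E ⊤                      ≡⟨ cong (#components E) (⊤-++ A.#E) ⟩
    #components E (⊤ {A.#E} ++ ⊤ {B.#E}) ≡⟨ ℕ.suc-injective (≡.trans
                                             (#components-union A.ends B.ends ⊤ ⊤)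
                                             (cong₂ _+ℕ_ oneA oneB)) ⟩
    1                                    ∎)
    (#components-pos A∪B.ends ⊤)
    where
    open ℕ.≤-Reasoning
    E = union A.ends B.ends

  module _ (G : SpanningSubgraph A.graph) (H : SpanningSubgraph B.graph) where

    joined-outside : Joined A∪B (outside ∷ (G ++ H)) ⇔ (Joined A G × Joined B H)
    joined-outside = mk⇔
      (λ j → Equivalence.to specials
        (EqClosure.map (Adjacent-outside⁻ (union A.ends B.ends)) j))
      (λ j → EqClosure.map (Adjacent-suc (union A.ends B.ends)) (Equivalence.from specials j))
      where specials = specials-linked A.ends B.ends G H

    joined-inside : Joined A∪B (inside ∷ (G ++ H))
    joined-inside = EqClosure.return (zero , here , ≡.refl)

    private
      cA = corank A G
      cB = corank B H

      nA = nullity A.graph G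
      nB = nullity B.graph H

      -- In every use `m` is the successor of the count without the new edge, and `c` is the corank
      -- in question plus one, or plus two if the new edge merges components.
      corank-suc : ∀ {c m} → m ≡ k A.graph G +ℕ k B.graph H → suc c ≡ m →
                   c ≡ suc (cA +ℕ cB)
      corank-suc {c} eq eq′ = ℕ.suc-injective (begin
        suc c                    ≡⟨ ≡.trans eq′ eq ⟩
        k A.graph G +ℕ k B.graph H ≡⟨ cong₂ _+ℕ_ (suc-corank A oneA G) (suc-corank B oneB H) ⟨
        suc (cA +ℕ suc cB)        ≡⟨ cong suc (ℕ.+-suc cA cB) ⟩
        suc (suc (cA +ℕ cB))      ∎)
        where open ≡-Reasoning

      -- The vertex counts on both sides cancel. Here `j` is what the new edge adds to the nullity:
      -- 1 if it closes a cycle, otherwise 0.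
      split-nullity : ∀ j {n h} → n +ℕ (A.#V-1 +ℕ B.#V-1) ≡ h →
                      h ≡ j +ℕ (∣ G ∣ +ℕ ∣ H ∣ +ℕ (cA +ℕ cB)) →
                      n ≡ j +ℕ (nA +ℕ nB)
      split-nullity j {n} {h} eq eq′ = ℕ.+-cancelʳ-≡ (A.#V-1 +ℕ B.#V-1) n _ (begin
        n +ℕ (A.#V-1 +ℕ B.#V-1)                ≡⟨ ≡.trans eq eq′ ⟩
        j +ℕ (∣ G ∣ +ℕ ∣ H ∣ +ℕ (cA +ℕ cB))      ≡⟨ cong (j +ℕ_) (interchange ∣ G ∣ ∣ H ∣ cA cB) ⟩
        j +ℕ ((∣ G ∣ +ℕ cA) +ℕ (∣ H ∣ +ℕ cB))
          ≡⟨ cong (j +ℕ_) (cong₂ _+ℕ_ (nullity+#V-1 A oneA G) (nullity+#V-1 B oneB H)) ⟨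
        j +ℕ ((nA +ℕ A.#V-1) +ℕ (nB +ℕ B.#V-1))  ≡⟨ cong (j +ℕ_) (interchange nA A.#V-1 nB B.#V-1) ⟩
        j +ℕ ((nA +ℕ nB) +ℕ (A.#V-1 +ℕ B.#V-1))  ≡⟨ ℕ.+-assoc j (nA +ℕ nB) _ ⟨
        j +ℕ (nA +ℕ nB) +ℕ (A.#V-1 +ℕ B.#V-1)    ∎)
        where open ≡-Reasoning

      out in′ : SpanningSubgraph A∪B.graph
      out = outside ∷ (G ++ H)
      in′ = inside ∷ (G ++ H)

      suc-k-out : suc (k A∪B.graph out) ≡ k A.graph G +ℕ k B.graph H
      suc-k-out = #components-union A.ends B.ends G H

    corank-outside : corank A∪B out ≡ cA +ℕ cB
    corank-outside = ℕ.suc-injective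
      (corank-suc suc-k-out (cong suc (suc-corank A∪B glue-oneComponent out)))

    nullity-outside : nullity A∪B.graph out ≡ nA +ℕ nB
    nullity-outside = split-nullity 0 (nullity+#V-1 A∪B glue-oneComponent out)
      (cong₂ _+ℕ_ (∣++∣ G H) corank-outside)

    module _ (joined : Joined A∪B out) where

      private
        k-in : k A∪B.graph in′ ≡ k A∪B.graph out
        k-in = #components-linked (union A.ends B.ends) (G ++ H)
          (EqClosure.map (Adjacent-outside⁻ (union A.ends B.ends)) joined)

      corank-inside-joined : corank A∪B in′ ≡ cA +ℕ cB
      corank-inside-joined = ℕ.suc-injective (corank-suc suc-k-out
        (cong suc (≡.trans (suc-corank A∪B glue-oneComponent in′) k-in)))

      nullity-inside-joined : nullity A∪B.graph in′ ≡ suc (nA +ℕ nB)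
      nullity-inside-joined = split-nullity 1 (nullity+#V-1 A∪B glue-oneComponent in′)
        (cong₂ (λ h c → suc (h +ℕ c)) (∣++∣ G H) corank-inside-joined)

    module _ (separate : ¬ Joined A∪B out) where

      private
        k-in : suc (k A∪B.graph in′) ≡ k A∪B.graph out
        k-in = #components-merge (union A.ends B.ends) (G ++ H)
          (separate ∘ EqClosure.map (Adjacent-suc (union A.ends B.ends)))

      corank-inside-separate : suc (corank A∪B in′) ≡ cA +ℕ cB
      corank-inside-separate = ℕ.suc-injective (corank-suc suc-k-out
        (cong suc (≡.trans (cong suc (suc-corank A∪B glue-oneComponent in′)) k-in)))

      nullity-inside-separate : nullity A∪B.graph in′ ≡ nA +ℕ nB
      nullity-inside-separate = split-nullity 0 (nullity+#V-1 A∪B glue-oneComponent in′)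
        -- The extra edge is balanced by the loss of one in the corank, so `j` is 0.
        (≡.trans (≡.sym (ℕ.+-suc ∣ G ++ H ∣ _)) (cong₂ _+ℕ_ (∣++∣ G H) corank-inside-separate))

-- Sums over subsets and over pairs of subsets

module SubsetSums {c ℓ} (R : CommutativeRing c ℓ) where

  open CommutativeRing R hiding (zero)
  open CommutativeSemigroupProperties +-commutativeSemigroup using ()
    renaming (interchange to +-interchange; x∙yz≈y∙xz to x+[y+z]≈y+[x+z])
  open SetoidReasoning setoid

  -- Masking by zero replaces filtered sums by sums over all subsets, which can then be compared
  -- pair by pair.
  when : ∀ {ℓ′} {P : Set ℓ′} → Dec P → Carrier → Carrier
  when P? a = if does P? then a else 0#

  when-yes : ∀ {ℓ′} {P : Set ℓ′} (P? : Dec P) {a} → P → when P? a ≡ a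
  when-yes P? p = cong (if_then _ else 0#) (dec-true P? p)

  when-no : ∀ {ℓ′} {P : Set ℓ′} (P? : Dec P) {a} → ¬ P → when P? a ≡ 0#
  when-no P? ¬p = cong (if_then _ else 0#) (dec-false P? ¬p)

  module _ {a} {A : Set a} where

    ∑ : (A → Carrier) → List A → Carrier
    ∑ f = foldr (λ x s → f x + s) 0#

    ∑-cong : ∀ {f g} → (∀ x → f x ≈ g x) → ∀ xs → ∑ f xs ≈ ∑ g xs
    ∑-cong f≈g []       = refl
    ∑-cong f≈g (x ∷ xs) = +-cong (f≈g x) (∑-cong f≈g xs)

    ∑-++ : ∀ f xs ys → ∑ f (xs List.++ ys) ≈ ∑ f xs + ∑ f ys
    ∑-++ f []       ys = sym (+-identityˡ _)
    ∑-++ f (x ∷ xs) ys = trans (+-congˡ (∑-++ f xs ys)) (sym (+-assoc _ _ _))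

    ∑-+ : ∀ f g xs → ∑ (λ x → f x + g x) xs ≈ ∑ f xs + ∑ g xs
    ∑-+ f g []       = sym (+-identityˡ 0#)
    ∑-+ f g (x ∷ xs) = trans (+-congˡ (∑-+ f g xs)) (+-interchange _ _ _ _)

    *-∑ : ∀ r f xs → r * ∑ f xs ≈ ∑ (λ x → r * f x) xs
    *-∑ r f []       = zeroʳ r
    *-∑ r f (x ∷ xs) = trans (distribˡ r _ _) (+-congˡ (*-∑ r f xs))

    ∑-* : ∀ r f xs → ∑ f xs * r ≈ ∑ (λ x → f x * r) xs
    ∑-* r f []       = zeroˡ r
    ∑-* r f (x ∷ xs) = trans (distribʳ r _ _) (+-congˡ (∑-* r f xs))

    ∑-filter : ∀ {ℓ′} {P : Pred A ℓ′} (P? : Decidable P) f xs →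
               ∑ f (filter P? xs) ≈ ∑ (λ x → when (P? x) (f x)) xs
    ∑-filter P? f []       = refl
    ∑-filter P? f (x ∷ xs) with does (P? x)
    ... | true  = +-congˡ (∑-filter P? f xs)
    ... | false = trans (∑-filter P? f xs) (sym (+-identityˡ _))

    ∑-partition : ∀ {ℓ′} {P : Pred A ℓ′} (P? : Decidable P) f xs →
                  ∑ f xs ≈ ∑ f (filter P? xs) + ∑ f (filter (¬? ∘ P?) xs)
    ∑-partition P? f []       = sym (+-identityˡ 0#)
    ∑-partition P? f (x ∷ xs) with does (P? x)
    ... | true  = trans (+-congˡ (∑-partition P? f xs)) (sym (+-assoc _ _ _))
    ... | false = trans (+-congˡ (∑-partition P? f xs)) (x+[y+z]≈y+[x+z] _ _ _)

  ∑-map : ∀ {a b} {A : Set a} {B : Set b} (f : B → Carrier) (g : A → B) xs →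
          ∑ f (map g xs) ≡ ∑ (f ∘ g) xs
  ∑-map f g []       = ≡.refl
  ∑-map f g (x ∷ xs) = cong (f (g x) +_) (∑-map f g xs)

  ∑-subsets-suc : ∀ n (f : Subset (suc n) → Carrier) →
                  ∑ f (allSubsets (suc n)) ≈
                  ∑ (f ∘ (outside ∷_)) (allSubsets n) + ∑ (f ∘ (inside ∷_)) (allSubsets n)
  ∑-subsets-suc n f = trans
    (∑-++ f (map (outside ∷_) (allSubsets n)) _)
    (+-cong (reflexive (∑-map f _ (allSubsets n))) (reflexive (∑-map f _ (allSubsets n))))

  module _ (m n : ℕ) where

    ∬ : (Subset m → Subset n → Carrier) → Carrier
    ∬ f = ∑ (λ G → ∑ (f G) (allSubsets n)) (allSubsets m)

    ∬-cong : ∀ {f g} → (∀ G H → f G H ≈ g G H) → ∬ f ≈ ∬ g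
    ∬-cong f≈g = ∑-cong (λ G → ∑-cong (f≈g G) (allSubsets n)) (allSubsets m)

    ∬-+ : ∀ f g → ∬ (λ G H → f G H + g G H) ≈ ∬ f + ∬ g
    ∬-+ f g = trans (∑-cong (λ G → ∑-+ (f G) (g G) (allSubsets n)) (allSubsets m)) (∑-+ _ _ (allSubsets m))

    *-∬ : ∀ r f → r * ∬ f ≈ ∬ (λ G H → r * f G H)
    *-∬ r f = trans (*-∑ r _ (allSubsets m)) (∑-cong (λ G → *-∑ r (f G) (allSubsets n)) (allSubsets m))

    ∬-product : ∀ f g → ∬ (λ G H → f G * g H) ≈ ∑ f (allSubsets m) * ∑ g (allSubsets n)
    ∬-product f g = sym (trans (∑-* _ f (allSubsets m))
      (∑-cong (λ G → *-∑ (f G) g (allSubsets n)) (allSubsets m)))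

    ∬-sums : ∀ {f g s t} → s ≈ ∑ f (allSubsets m) → t ≈ ∑ g (allSubsets n) →
             ∬ (λ G H → f G * g H) ≈ s * t
    ∬-sums {f} {g} s≈ t≈ = trans (∬-product f g) (sym (*-cong s≈ t≈))

  ∑-subsets-++ : ∀ m n (f : Subset (m +ℕ n) → Carrier) →
                 ∑ f (allSubsets (m +ℕ n)) ≈ ∬ m n (λ G H → f (G ++ H))
  ∑-subsets-++ zero    n f = sym (+-identityʳ _)
  ∑-subsets-++ (suc m) n f = begin
    ∑ f (allSubsets (suc m +ℕ n))
      ≈⟨ ∑-subsets-suc (m +ℕ n) f ⟩
    ∑ (f ∘ (outside ∷_)) (allSubsets (m +ℕ n)) + ∑ (f ∘ (inside ∷_)) (allSubsets (m +ℕ n))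
      ≈⟨ +-cong (∑-subsets-++ m n _) (∑-subsets-++ m n _) ⟩
    ∬ m n (λ G H → f (outside ∷ (G ++ H))) + ∬ m n (λ G H → f (inside ∷ (G ++ H)))
      ≈⟨ ∑-subsets-suc m _ ⟨
    ∬ (suc m) n (λ G H → f (G ++ H)) ∎

  -- The new edge heads the edge list of a glued graph; collecting both choices for it under the
  -- same pair allows a termwise comparison.
  ∑-subsets-edge : ∀ m n (f : Subset (suc (m +ℕ n)) → Carrier) →
                   ∑ f (allSubsets (suc (m +ℕ n))) ≈
                   ∬ m n (λ G H → f (outside ∷ (G ++ H)) + f (inside ∷ (G ++ H)))
  ∑-subsets-edge m n f = begin
    ∑ f (allSubsets (suc (m +ℕ n)))
      ≈⟨ ∑-subsets-suc (m +ℕ n) f ⟩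
    ∑ (f ∘ (outside ∷_)) (allSubsets (m +ℕ n)) + ∑ (f ∘ (inside ∷_)) (allSubsets (m +ℕ n))
      ≈⟨ +-cong (∑-subsets-++ m n _) (∑-subsets-++ m n _) ⟩
    ∬ m n (λ G H → f (outside ∷ (G ++ H))) + ∬ m n (λ G H → f (inside ∷ (G ++ H)))
      ≈⟨ ∬-+ m n _ _ ⟨
    ∬ m n (λ G H → f (outside ∷ (G ++ H)) + f (inside ∷ (G ++ H))) ∎

-- Rank-nullity sums of a glued graph

-- p and q stand for x - 1 and y - 1.

module RankNullity {c ℓ} (R : CommutativeRing c ℓ) (p q : CommutativeRing.Carrier R) where

  open CommutativeRing R hiding (zero)
  open Exp semiring using (_^_; ^-homo-*; ^-congʳ)
  open SemiringSolver commutativeSemiring using (solve; _:=_; _:+_; _:*_; con)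
  open SubsetSums R
  open SetoidReasoning setoid
  open CommutativeSemigroupProperties *-commutativeSemigroup using ()
    renaming (interchange to *-interchange; x∙yz≈y∙xz to x*[y*z]≈y*[x*z])

  term : (G : MarkedGraph) → SpanningSubgraph (MarkedGraph.graph G) → Carrier
  term G H = p ^ corank G H * q ^ nullity (MarkedGraph.graph G) H

  module _ (G : MarkedGraph) where
    open MarkedGraph G

    joinedTerm separateTerm : SpanningSubgraph graph → Carrier
    joinedTerm   H = when (joined? G H) (term G H)
    separateTerm H = when (¬? (joined? G H)) (term G H)

    joinedSum separateSum : Carrier
    joinedSum   = ∑ (term G) (filter (joined? G) (spanningSubgraphs graph))
    separateSum = ∑ (term G) (filter (¬? ∘ joined? G) (spanningSubgraphs graph))

    ∑-joinedTerm : joinedSum ≈ ∑ joinedTerm (allSubsets #E)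
    ∑-joinedTerm = ∑-filter (joined? G) (term G) (allSubsets #E)

    ∑-separateTerm : separateSum ≈ ∑ separateTerm (allSubsets #E)
    ∑-separateTerm = ∑-filter (¬? ∘ joined? G) (term G) (allSubsets #E)

  monomial-* : ∀ {c n} c₁ n₁ c₂ n₂ → c ≡ c₁ +ℕ c₂ → n ≡ n₁ +ℕ n₂ →
               p ^ c * q ^ n ≈ (p ^ c₁ * q ^ n₁) * (p ^ c₂ * q ^ n₂)
  monomial-* c₁ n₁ c₂ n₂ ≡.refl ≡.refl =
    trans (*-cong (^-homo-* p c₁ c₂) (^-homo-* q n₁ n₂)) (*-interchange _ _ _ _)

  -- This is `(a₁ + a₂) * (b₁ + b₂)` without its summand `a₁ * b₁`, expanded so that no subtraction
  -- occurs; both recurrences contain it.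
  atLeastOneSeparate : (a₁ a₂ b₁ b₂ : Carrier) → Carrier
  atLeastOneSeparate a₁ a₂ b₁ b₂ = a₁ * b₂ + (a₂ * b₁ + a₂ * b₂)

  none-separate : ∀ a b → atLeastOneSeparate a 0# b 0# ≈ 0#
  none-separate = solve 2 (λ a b →
    a :* con 0 :+ (con 0 :* b :+ con 0 :* con 0) := con 0) refl

  right-separate : ∀ a b → atLeastOneSeparate a 0# 0# b ≈ a * b
  right-separate = solve 2 (λ a b →
    a :* b :+ (con 0 :* con 0 :+ con 0 :* b) := a :* b) refl

  left-separate : ∀ a b → atLeastOneSeparate 0# a b 0# ≈ a * b
  left-separate = solve 2 (λ a b →
    con 0 :* con 0 :+ (a :* b :+ a :* con 0) := a :* b) refl

  both-separate : ∀ a b → atLeastOneSeparate 0# a 0# b ≈ a * b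
  both-separate = solve 2 (λ a b →
    con 0 :* b :+ (a :* con 0 :+ a :* b) := a :* b) refl

  -- a, b, o and i stand for the terms of a subgraph of A, of a subgraph of B,
  -- and of their union without and with the new edge; index 1 is for those
  -- subgraphs that join the special vertices and index 2 for the others.

  Contributions : (a₁ a₂ b₁ b₂ o₁ o₂ i₁ i₂ : Carrier) → Set ℓ
  Contributions a₁ a₂ b₁ b₂ o₁ o₂ i₁ i₂ =
    (p * (o₁ + i₁) ≈ p * ((1# + q) * (a₁ * b₁)) + atLeastOneSeparate a₁ a₂ b₁ b₂)
    × (o₂ + i₂ ≈ atLeastOneSeparate a₁ a₂ b₁ b₂)

  -- The new edge closes a cycle, so the two unions together give `(1# + q) * (a * b)`: the origin
  -- of the coefficient y.
  contributions-joined :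
    ∀ {a b a₁ a₂ b₁ b₂ o₁ o₂ i₁ i₂} →
    a₁ ≡ a → a₂ ≡ 0# → b₁ ≡ b → b₂ ≡ 0# →
    o₁ ≈ a * b → o₂ ≡ 0# → i₁ ≈ q * (a * b) → i₂ ≡ 0# →
    Contributions a₁ a₂ b₁ b₂ o₁ o₂ i₁ i₂
  contributions-joined {a} {b} ≡.refl ≡.refl ≡.refl ≡.refl o₁≈ ≡.refl i₁≈ ≡.refl =
    (begin
      p * (_ + _)                     ≈⟨ *-congˡ (+-cong o₁≈ i₁≈) ⟩
      p * (ab + q * ab)               ≈⟨ *-congˡ (trans (distribʳ ab 1# q) (+-congʳ (*-identityˡ ab))) ⟨
      p * ((1# + q) * ab)             ≈⟨ +-identityʳ _ ⟨
      p * ((1# + q) * ab) + 0#        ≈⟨ +-congˡ (none-separate a b) ⟨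
      p * ((1# + q) * ab) + atLeastOneSeparate a 0# b 0# ∎) ,
    trans (+-identityʳ 0#) (sym (none-separate a b))
    where ab = a * b

  -- Common to the three cases with a separate half: the union counts as separate without the new
  -- edge and as joined with it, and `t` is the product of the two terms. The masked values `x₁` to
  -- `y₂` differ only in which are zero.
  contributions-separate :
    ∀ {t x₁ x₂ y₁ y₂ a₁ a₂ b₁ b₂ o₁ o₂ i₁ i₂} →
    a₁ ≡ x₁ → a₂ ≡ x₂ → b₁ ≡ y₁ → b₂ ≡ y₂ →
    x₁ * y₁ ≈ 0# → atLeastOneSeparate x₁ x₂ y₁ y₂ ≈ t →
    o₁ ≡ 0# → o₂ ≈ t → p * i₁ ≈ t → i₂ ≡ 0# →
    Contributions a₁ a₂ b₁ b₂ o₁ o₂ i₁ i₂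
  contributions-separate {t} {a₁} {a₂} {b₁} {b₂} {i₁ = i₁}
    ≡.refl ≡.refl ≡.refl ≡.refl ab≈0 mixed≈t ≡.refl o₂≈t pi₁≈t ≡.refl =
    (begin
      p * (0# + i₁)                          ≈⟨ *-congˡ (+-identityˡ i₁) ⟩
      p * i₁                                 ≈⟨ pi₁≈t ⟩
      t                                      ≈⟨ mixed≈t ⟨
      mixed                                  ≈⟨ +-identityˡ mixed ⟨
      0# + mixed                             ≈⟨ +-congʳ (trans (*-congˡ (zeroʳ (1# + q))) (zeroʳ p)) ⟨
      p * ((1# + q) * 0#) + mixed            ≈⟨ +-congʳ (*-congˡ (*-congˡ ab≈0)) ⟨
      p * ((1# + q) * (a₁ * b₁)) + mixed     ∎) ,
    trans (+-identityʳ _) (trans o₂≈t (sym mixed≈t))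
    where mixed = atLeastOneSeparate a₁ a₂ b₁ b₂

  module _ (A B : MarkedGraph) (oneA : OneComponent A) (oneB : OneComponent B) where

    private
      module A = MarkedGraph A
      module B = MarkedGraph B
      A∪B = glue A B
    open GlueExponents A B oneA oneB

    module _ (G : SpanningSubgraph A.graph) (H : SpanningSubgraph B.graph) where

      private
        out in′ : SpanningSubgraph (MarkedGraph.graph A∪B)
        out = outside ∷ (G ++ H)
        in′ = inside ∷ (G ++ H)
        a = term A G
        b = term B H

      term-outside : term A∪B out ≈ a * b
      term-outside = monomial-* (corank A G) (nullity A.graph G) (corank B H) (nullity B.graph H)
        (corank-outside G H) (nullity-outside G H)

      term-inside-joined : Joined A∪B out → term A∪B in′ ≈ q * (a * b)
      term-inside-joined j = begin
        term A∪B in′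
          ≈⟨ *-congˡ (^-congʳ q (nullity-inside-joined G H j)) ⟩
        p ^ corank A∪B in′ * (q * q ^ (nullity A.graph G +ℕ nullity B.graph H))
          ≈⟨ x*[y*z]≈y*[x*z] _ _ _ ⟩
        q * (p ^ corank A∪B in′ * q ^ (nullity A.graph G +ℕ nullity B.graph H))
          ≈⟨ *-congˡ (monomial-* (corank A G) (nullity A.graph G)
                        (corank B H) (nullity B.graph H) (corank-inside-joined G H j) ≡.refl) ⟩
        q * (a * b) ∎

      term-inside-separate : ¬ Joined A∪B out → p * term A∪B in′ ≈ a * b
      -- `p * p ^ c` is `p ^ suc c` by computation, so the factor `p` restores the exponent lost to
      -- the merge.
      term-inside-separate ¬j = trans (sym (*-assoc p _ _))
        (monomial-* (corank A G) (nullity A.graph G) (corank B H) (nullity B.graph H)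
          (corank-inside-separate G H ¬j) (nullity-inside-separate G H ¬j))

      contributions :
        Contributions (joinedTerm A G) (separateTerm A G) (joinedTerm B H) (separateTerm B H)
          (joinedTerm A∪B out) (separateTerm A∪B out) (joinedTerm A∪B in′) (separateTerm A∪B in′)
      contributions = by-cases (joined? A G) (joined? B H)
        where
        yes₁ : ∀ C K → Joined C K → joinedTerm C K ≡ term C K
        yes₁ C K = when-yes (joined? C K)
        yes₂ : ∀ C K → Joined C K → separateTerm C K ≡ 0#
        yes₂ C K j = when-no (¬? (joined? C K)) (λ ¬j → ¬j j)
        no₁ : ∀ C K → ¬ Joined C K → joinedTerm C K ≡ 0#
        no₁ C K = when-no (joined? C K)
        no₂ : ∀ C K → ¬ Joined C K → separateTerm C K ≡ term C K
        no₂ C K = when-yes (¬? (joined? C K))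

        a₁ = joinedTerm A G
        a₂ = separateTerm A G
        b₁ = joinedTerm B H
        b₂ = separateTerm B H

        Goal = Contributions a₁ a₂ b₁ b₂ (joinedTerm A∪B out) (separateTerm A∪B out)
                                         (joinedTerm A∪B in′) (separateTerm A∪B in′)

        separate : ∀ {x₁ x₂ y₁ y₂} → ¬ (Joined A G × Joined B H) →
                   a₁ ≡ x₁ → a₂ ≡ x₂ → b₁ ≡ y₁ → b₂ ≡ y₂ →
                   x₁ * y₁ ≈ 0# → atLeastOneSeparate x₁ x₂ y₁ y₂ ≈ a * b → Goal
        separate ¬both a₁≡ a₂≡ b₁≡ b₂≡ product≈0 mixed≈ab = contributions-separate
          a₁≡ a₂≡ b₁≡ b₂≡ product≈0 mixed≈ab
          (no₁ A∪B out ¬j)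
          (trans (reflexive (no₂ A∪B out ¬j)) term-outside)
          (trans (*-congˡ (reflexive (yes₁ A∪B in′ (joined-inside G H)))) (term-inside-separate ¬j))
          (yes₂ A∪B in′ (joined-inside G H))
          where ¬j = ¬both ∘ Equivalence.to (joined-outside G H)

        by-cases : Dec (Joined A G) → Dec (Joined B H) → Goal
        by-cases (yes jA) (yes jB) = contributions-joined
          (yes₁ A G jA) (yes₂ A G jA) (yes₁ B H jB) (yes₂ B H jB)
          (trans (reflexive (yes₁ A∪B out j)) term-outside)
          (yes₂ A∪B out j)
          (trans (reflexive (yes₁ A∪B in′ (joined-inside G H))) (term-inside-joined j))
          (yes₂ A∪B in′ (joined-inside G H))
          where j = Equivalence.from (joined-outside G H) (jA , jB)
        by-cases (yes jA) (no ¬jB) = separate (¬jB ∘ proj₂)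
          (yes₁ A G jA) (yes₂ A G jA) (no₁ B H ¬jB) (no₂ B H ¬jB)
          (zeroʳ a) (right-separate a b)
        by-cases (no ¬jA) (yes jB) = separate (¬jA ∘ proj₁)
          (no₁ A G ¬jA) (no₂ A G ¬jA) (yes₁ B H jB) (yes₂ B H jB)
          (zeroˡ b) (left-separate a b)
        by-cases (no ¬jA) (no ¬jB) = separate (¬jA ∘ proj₁)
          (no₁ A G ¬jA) (no₂ A G ¬jA) (no₁ B H ¬jB) (no₂ B H ¬jB)
          (zeroˡ 0#) (both-separate a b)

    private
      A₁ = joinedSum A
      A₂ = separateSum A
      B₁ = joinedSum B
      B₂ = separateSum B

      -- The expression is bilinear in the values for the two halves, so summing over independent
      -- pairs passes to its arguments.
      ∬-atLeastOneSeparate :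
        ∬ A.#E B.#E (λ G H → atLeastOneSeparate (joinedTerm A G) (separateTerm A G)
                                      (joinedTerm B H) (separateTerm B H)) ≈
        atLeastOneSeparate A₁ A₂ B₁ B₂
      ∬-atLeastOneSeparate = trans (∬-+ A.#E B.#E _ _) (+-cong
        (∬-sums A.#E B.#E (∑-joinedTerm A) (∑-separateTerm B))
        (trans (∬-+ A.#E B.#E _ _) (+-cong
          (∬-sums A.#E B.#E (∑-separateTerm A) (∑-joinedTerm B))
          (∬-sums A.#E B.#E (∑-separateTerm A) (∑-separateTerm B)))))

    joinedSum-glue :
      p * joinedSum A∪B ≈ p * ((1# + q) * (A₁ * B₁)) + atLeastOneSeparate A₁ A₂ B₁ B₂
    joinedSum-glue = begin
      p * joinedSum A∪B
        ≈⟨ *-congˡ (trans (∑-joinedTerm A∪B) (∑-subsets-edge A.#E B.#E (joinedTerm A∪B))) ⟩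
      p * ∬ A.#E B.#E (λ G H → joinedTerm A∪B (outside ∷ (G ++ H)) + joinedTerm A∪B (inside ∷ (G ++ H)))
        ≈⟨ *-∬ A.#E B.#E p _ ⟩
      ∬ A.#E B.#E (λ G H → p * (joinedTerm A∪B (outside ∷ (G ++ H)) + joinedTerm A∪B (inside ∷ (G ++ H))))
        ≈⟨ ∬-cong A.#E B.#E (λ G H → proj₁ (contributions G H)) ⟩
      ∬ A.#E B.#E (λ G H → p * ((1# + q) * (joinedTerm A G * joinedTerm B H)) + mixed G H)
        ≈⟨ ∬-+ A.#E B.#E _ _ ⟩
      ∬ A.#E B.#E (λ G H → p * ((1# + q) * (joinedTerm A G * joinedTerm B H))) + ∬ A.#E B.#E mixed
        ≈⟨ +-cong (begin
             ∬ A.#E B.#E (λ G H → p * ((1# + q) * (joinedTerm A G * joinedTerm B H)))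
               ≈⟨ *-∬ A.#E B.#E p _ ⟨
             p * ∬ A.#E B.#E (λ G H → (1# + q) * (joinedTerm A G * joinedTerm B H))
               ≈⟨ *-congˡ (*-∬ A.#E B.#E (1# + q) _) ⟨
             p * ((1# + q) * ∬ A.#E B.#E (λ G H → joinedTerm A G * joinedTerm B H))
               ≈⟨ *-congˡ (*-congˡ (∬-sums A.#E B.#E (∑-joinedTerm A) (∑-joinedTerm B))) ⟩
             p * ((1# + q) * (A₁ * B₁)) ∎)
           ∬-atLeastOneSeparate ⟩
      p * ((1# + q) * (A₁ * B₁)) + atLeastOneSeparate A₁ A₂ B₁ B₂ ∎
      where
      mixed : SpanningSubgraph A.graph → SpanningSubgraph B.graph → Carrier
      mixed G H = atLeastOneSeparate (joinedTerm A G) (separateTerm A G)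
                                     (joinedTerm B H) (separateTerm B H)

    separateSum-glue : separateSum A∪B ≈ atLeastOneSeparate A₁ A₂ B₁ B₂
    separateSum-glue = begin
      separateSum A∪B
        ≈⟨ trans (∑-separateTerm A∪B) (∑-subsets-edge A.#E B.#E (separateTerm A∪B)) ⟩
      ∬ A.#E B.#E (λ G H → separateTerm A∪B (outside ∷ (G ++ H)) + separateTerm A∪B (inside ∷ (G ++ H)))
        ≈⟨ ∬-cong A.#E B.#E (λ G H → proj₂ (contributions G H)) ⟩
      ∬ A.#E B.#E (λ G H → atLeastOneSeparate (joinedTerm A G) (separateTerm A G)
                                    (joinedTerm B H) (separateTerm B H))
        ≈⟨ ∬-atLeastOneSeparate ⟩
      atLeastOneSeparate A₁ A₂ B₁ B₂ ∎

-- Recurrences for the Farey graphs over a commutative ring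

farey-oneComponent : ∀ n → OneComponent (farey n)
farey-oneComponent zero    = ≡.refl
farey-oneComponent (suc n) = GlueExponents.glue-oneComponent
  (farey n) (farey n) (farey-oneComponent n) (farey-oneComponent n)

module FareySums {c ℓ} (R : CommutativeRing c ℓ) (x y : CommutativeRing.Carrier R) where

  open CommutativeRing R hiding (zero)
  open SubsetSums R using (∑; ∑-partition)
  open RankNullity R (x - 1#) (y - 1#)

  -- For the ring ℤ[x,y] these unfold to `T`, `T₁` and `T₂`, so results over an abstract ring apply
  -- to the latter directly.
  total joined separate : ℕ → Carrier
  total n = ∑ (term (farey n)) (spanningSubgraphs (MarkedGraph.graph (farey n)))
  joined n = joinedSum (farey n)
  separate n = separateSum (farey n)

  total-split : ∀ n → total n ≈ joined n + separate n
  total-split n = ∑-partition (joined? (farey n)) (term (farey n))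
    (spanningSubgraphs (MarkedGraph.graph (farey n)))

  joined-recurrence : ∀ n → (x - 1#) * joined (suc n) ≈
    (x - 1#) * (y * (joined n * joined n))
      + (joined n * separate n + (separate n * joined n + separate n * separate n))
  joined-recurrence n = trans
    (joinedSum-glue (farey n) (farey n) (farey-oneComponent n) (farey-oneComponent n))
    (+-congʳ (*-congˡ (*-congʳ 1+[y-1]≈y)))
    where
    1+[y-1]≈y : 1# + (y - 1#) ≈ y
    1+[y-1]≈y = trans (sym (+-assoc 1# y _))
      (AbelianGroupProperties.xyx⁻¹≈y +-abelianGroup 1# y)

  separate-recurrence : ∀ n →
    separate (suc n) ≈ joined n * separate n + (separate n * joined n + separate n * separate n)
  separate-recurrence n =
    separateSum-glue (farey n) (farey n) (farey-oneComponent n) (farey-oneComponent n)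

  -- The filter evaluates and keeps only the edge itself, whose exponents are both 0; in
  -- `separate-zero` the edgeless subgraph remains, with corank 1.
  joined-zero : joined 0 ≈ 1#
  joined-zero = trans (+-identityʳ _) (*-identityʳ 1#)

  separate-zero : separate 0 ≈ x - 1#
  separate-zero = trans (+-identityʳ _) (trans (*-identityʳ _) (*-identityʳ _))

-- Division by x - 1

module Division {c ℓ} (R : CommutativeRing c ℓ) where

  open CommutativeRing R hiding (zero)
  open Exp semiring using (_^_)
  open SemiringSolver commutativeSemiring using (solve; _:=_; _:+_; _:*_)
  open SetoidReasoning setoid

  -- Multiplying by the inverse `i` of `d` cancels `d`. The coefficient `j` is separate because
  -- 2/(x-1) is a single fraction in the theorem, equal to twice 1/(x-1) only up to `≈`.
  divided-recurrence :
    ∀ i j d t y a b → i * d ≈ 1# → j ≈ (1# + 1#) * i →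
    d * t ≈ d * (y * (a * a)) + (a * b + (b * a + b * b)) →
    t ≈ y * a ^ 2 + j * (a * b) + i * b ^ 2
  divided-recurrence i j d t y a b id≈1 j≈2i dt≈ = begin
    t                                                          ≈⟨ cancel t ⟨
    i * (d * t)                                                ≈⟨ *-congˡ dt≈ ⟩
    i * (d * (y * (a * a)) + (a * b + (b * a + b * b)))        ≈⟨ distribˡ i _ _ ⟩
    i * (d * (y * (a * a))) + i * (a * b + (b * a + b * b))    ≈⟨ +-congʳ (cancel _) ⟩
    y * (a * a) + i * (a * b + (b * a + b * b))                ≈⟨ +-congˡ (double i a b) ⟩
    y * (a * a) + (i * ((a * b) + (a * b)) + i * (b * b))      ≈⟨ +-assoc _ _ _ ⟨
    y * (a * a) + i * ((a * b) + (a * b)) + i * (b * b)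
      ≈⟨ +-cong (+-cong (*-congˡ (square a)) (twice i (a * b))) (*-congˡ (square b)) ⟩
    y * a ^ 2 + ((1# + 1#) * i) * (a * b) + i * b ^ 2          ≈⟨ +-congʳ (+-congˡ (*-congʳ j≈2i)) ⟨
    y * a ^ 2 + j * (a * b) + i * b ^ 2                        ∎
    where
    cancel : ∀ z → i * (d * z) ≈ z
    cancel z = trans (sym (*-assoc i d z)) (trans (*-congʳ id≈1) (*-identityˡ z))

    double : ∀ i a b → i * (a * b + (b * a + b * b)) ≈ i * ((a * b) + (a * b)) + i * (b * b)
    double = solve 3 (λ i a b → i :* (a :* b :+ (b :* a :+ b :* b)) :=
      i :* ((a :* b) :+ (a :* b)) :+ i :* (b :* b)) refl

    square : ∀ a → a * a ≈ a ^ 2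
    square a = *-congˡ (sym (*-identityʳ a))

    twice : ∀ i z → i * (z + z) ≈ ((1# + 1#) * i) * z
    twice i z = begin
      i * (z + z)            ≈⟨ *-congˡ (+-cong (*-identityˡ z) (*-identityˡ z)) ⟨
      i * (1# * z + 1# * z)  ≈⟨ *-congˡ (distribʳ z 1# 1#) ⟨
      i * ((1# + 1#) * z)    ≈⟨ *-assoc i _ z ⟨
      i * (1# + 1#) * z      ≈⟨ *-congʳ (*-comm i _) ⟩
      (1# + 1#) * i * z      ∎

  symmetric-recurrence : ∀ a b → a * b + (b * a + b * b) ≈ b ^ 2 + (1# + 1#) * (a * b)
  symmetric-recurrence a b = begin
    a * b + (b * a + b * b)              ≈⟨ solve 2 (λ a b → a :* b :+ (b :* a :+ b :* b) :=
                                                b :* b :+ (a :* b :+ a :* b)) refl a b ⟩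
    b * b + (a * b + a * b)              ≈⟨ +-cong (*-congˡ (*-identityʳ b))
                                             (+-cong (*-identityˡ _) (*-identityˡ _)) ⟨
    b ^ 2 + (1# * (a * b) + 1# * (a * b)) ≈⟨ +-congˡ (distribʳ (a * b) 1# 1#) ⟨
    b ^ 2 + (1# + 1#) * (a * b)          ∎

-- Transfer to the field of fractions

module Embedding {c ℓ} (D : IntegralDomain c ℓ) where

  open FieldOfFractions D
  private
    module D = IntegralDomain D
    module F = CommutativeRing commutativeRing
  open Exp F.semiring using (_^_)
  open Division commutativeRing
  open SetoidReasoning F.setoid

  embed-cong : ∀ a b → a D.≈ b → embed a ≃ embed b
  embed-cong a b e = cross (D.*-congʳ e)

  embed-+ : ∀ a b → embed (a D.+ b) ≃ embed a ⊞ embed b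
  embed-+ a b = cross (D.*-cong
    (D.sym (D.+-cong (D.*-identityʳ a) (D.*-identityʳ b))) (D.*-identityˡ D.1#))

  embed-sum : ∀ t a b → t D.≈ a D.+ b → embed t ≃ embed a ⊞ embed b
  embed-sum t a b t≈ = F.trans (embed-cong t (a D.+ b) t≈) (embed-+ a b)

  embed-* : ∀ a b → embed (a D.* b) ≃ embed a ⊠ embed b
  embed-* a b = cross (D.*-congˡ (D.*-identityˡ D.1#))

  embed-quadratic : ∀ a b → embed (a D.* b D.+ (b D.* a D.+ b D.* b)) ≃
                    embed a ⊠ embed b ⊞ (embed b ⊠ embed a ⊞ embed b ⊠ embed b)
  embed-quadratic a b = F.trans (embed-+ (a D.* b) _) (F.+-cong (embed-* a b)
    (F.trans (embed-+ (b D.* a) _) (F.+-cong (embed-* b a) (embed-* b b))))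

  embed-symmetric-recurrence :
    ∀ t a b → t D.≈ a D.* b D.+ (b D.* a D.+ b D.* b) →
    embed t ≃ embed b ^ 2 ⊞ (F.1# ⊞ F.1#) ⊠ (embed a ⊠ embed b)
  embed-symmetric-recurrence t a b t≈ =
    F.trans (embed-cong t _ t≈) (F.trans (embed-quadratic a b)
      (symmetric-recurrence (embed a) (embed b)))

  module _ {d} (d≉0 : ¬ d D.≈ D.0#) where

    1/-inverse : (D.1# / d ∵ d≉0) ⊠ embed d ≃ F.1#
    1/-inverse = cross (D.trans (D.*-identityʳ _) (D.*-congˡ (D.sym (D.*-identityʳ d))))

    embed-divided-recurrence :
      ∀ t y a b → d D.* t D.≈ d D.* (y D.* (a D.* a)) D.+ (a D.* b D.+ (b D.* a D.+ b D.* b)) →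
      embed t ≃ embed y ⊠ embed a ^ 2 ⊞ ((D.1# D.+ D.1#) / d ∵ d≉0) ⊠ (embed a ⊠ embed b)
                ⊞ (D.1# / d ∵ d≉0) ⊠ embed b ^ 2
    embed-divided-recurrence t y a b dt≈ =
      divided-recurrence (D.1# / d ∵ d≉0) ((D.1# D.+ D.1#) / d ∵ d≉0)
        (embed d) (embed t) (embed y) (embed a) (embed b) 1/-inverse 2/≃ embedded
      where
      2/≃ : (D.1# D.+ D.1#) / d ∵ d≉0 ≃ (F.1# ⊞ F.1#) ⊠ (D.1# / d ∵ d≉0)
      2/≃ = cross (D.*-cong
        (D.sym (D.trans (D.*-identityʳ _) (D.+-cong (D.*-identityʳ D.1#) (D.*-identityʳ D.1#))))
        (D.trans (D.*-congʳ (D.*-identityʳ D.1#)) (D.*-identityˡ d)))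

      embedded : embed d ⊠ embed t ≃ embed d ⊠ (embed y ⊠ (embed a ⊠ embed a))
                   ⊞ (embed a ⊠ embed b ⊞ (embed b ⊠ embed a ⊞ embed b ⊠ embed b))
      embedded = begin
        embed d ⊠ embed t    ≈⟨ embed-* d t ⟨
        embed (d D.* t)      ≈⟨ embed-cong _ _ dt≈ ⟩
        embed (d D.* (y D.* (a D.* a)) D.+ (a D.* b D.+ (b D.* a D.+ b D.* b)))
          ≈⟨ embed-+ _ _ ⟩
        embed (d D.* (y D.* (a D.* a))) ⊞ embed (a D.* b D.+ (b D.* a D.+ b D.* b))
          ≈⟨ F.+-cong
               (F.trans (embed-* d _) (F.*-congˡ {embed d}
                 (F.trans (embed-* y _) (F.*-congˡ {embed y} (embed-* a a)))))
               (embed-quadratic a b) ⟩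
        embed d ⊠ (embed y ⊠ (embed a ⊠ embed a))
          ⊞ (embed a ⊠ embed b ⊞ (embed b ⊠ embed a ⊞ embed b ⊠ embed b)) ∎

theorem2 :
  let open ℚ⟨x,y⟩
      module P = ℤ[x,y]
      t  = λ n → embed (T n)
      t₁ = λ n → embed (T₁ n)
      t₂ = λ n → embed (T₂ n)
      2/[x-1] = (P.1# P.+ P.1#) / (x P.- P.1#) ∵ x-1≉0
      1/[x-1] = P.1# / (x P.- P.1#) ∵ x-1≉0
  in
  ((n : ℕ) →
      (t (suc n) ≈ t₁ (suc n) + t₂ (suc n))
    × (t₁ (suc n) ≈ embed y * t₁ n ^ 2 + 2/[x-1] * (t₁ n * t₂ n) + 1/[x-1] * t₂ n ^ 2)
    × (t₂ (suc n) ≈ t₂ n ^ 2 + (1# + 1#) * (t₁ n * t₂ n)))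
  × (t₁ 0 ≈ 1#)
  × (t₂ 0 ≈ embed x - 1#)
theorem2 =
  (λ n → embed-sum (T (suc n)) (T₁ (suc n)) (T₂ (suc n)) (total-split (suc n))
       , embed-divided-recurrence x-1≉0 (T₁ (suc n)) y (T₁ n) (T₂ n) (joined-recurrence n)
       , embed-symmetric-recurrence (T₂ (suc n)) (T₁ n) (T₂ n) (separate-recurrence n))
  , embed-cong (T₁ 0) ℤ[x,y].1# joined-zero
  -- Negation of fractions acts on numerators, so `embed x - 1#` unfolds to a sum of two embedded
  -- polynomials.
  , embed-sum (T₂ 0) x (ℤ[x,y].- ℤ[x,y].1#) separate-zero
  where
  open Embedding ℤ[x][y].domain
  open FareySums ℤ[x,y].commutativeRing x y
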